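{- Let $a,b\ge 1$ be integers and let $$F=\sum_{n\ge 0}\Big(\sum_{\pi\in NC_n}p^{\mu_{1^a}(\pi)}q^{\mu_{1^b2}(\pi)}\Big)x^n$$ be the generating function enumerating the members of $NC_n$ for $n\ge 0$ jointly according to the number of occurrences of the subwords $1^a$ and $1^b2$ (marked by $p$ and $q$, respectively). If $a\ge b\ge 1$, then $F$ satisfies $$\big(x-px^2+q(p-1)x^a+(q-1)(1-px)x^b\big)F^2=\big(1-px+q(p-1)x^a+(q-1)(1-px)x^b\big)F-1+px-(p-1)x^a.$$ If $1\le a<b$, then $F$ satisfies $$\big(x-px^2+(p-1)x^a+(q-1)(1-x)p^{b-a+1}x^b\big)F^2=\big(1-px+(p-1)x^a+(q-1)(1-x)p^{b-a+1}x^b\big)F-1+px-(p-1)x^a.$$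
   Context: A set partition of $[n]=\{1,\dots,n\}$ with blocks $B_1,\dots,B_k$ ordered so that $\min B_1<\cdots<\min B_k$ is represented by its canonical sequential form $\pi=\pi_1\cdots\pi_n$, where $i\in B_{\pi_i}$ for each $i$. It is non-crossing if $\pi$ contains no (not necessarily consecutive) subsequence of the form $a\,b\,a\,b$ with $a<b$. $NC_n$ denotes the set of non-crossing partitions of $[n]$, identified with their canonical sequential forms ($NC_0$ consists of the empty partition). A subword pattern is a finite sequence $\tau=\tau_1\cdots\tau_k$ of positive integers whose set of distinct letters is $[\ell]$ for some $\ell$. An occurrence of $\tau$ in a sequence $\rho_1\cdots\rho_n$ is an index $i\in[n-k+1]$ such that the string of consecutive letters $\rho_i\rho_{i+1}\cdots\rho_{i+k-1}$ is order-isomorphic to $\tau$ (same relative order, including equalities). $\mu_\tau(\pi)$ denotes the number of occurrences of $\tau$ in $\pi$. Exponents denote repetition of letters: $1^a$ is the word of $a$ ones, and $1^b2$ is $b$ ones followed by a $2$. $F$ is regarded as a formal power series in $x$ with coefficients in $\mathbb{Z}[p,q]$. -}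

module Defs where

open import Algebra.Bundles using (CommutativeRing)
import Algebra.Construct.Pointwise as Pointwise
open import Algebra.Structures using (IsAbelianGroup; IsCommutativeRing)
open import Data.Fin as Fin using (Fin; toℕ)
import Data.Fin.Properties as Fin
open import Data.Integer.Properties using () renaming (+-*-commutativeRing to ℤ-ring)
open import Data.List using
  (List; []; _∷_; [_]; _++_; length; map; filter; concatMap; cartesianProductWith;
   replicate; take; drop; zip; upTo; allFin; foldr)
open import Data.List.Relation.Unary.All as All using (All)
open import Data.Nat as ℕ using (ℕ; zero; suc; _∸_; z≤n; s≤s)
import Data.Nat.Properties as ℕ
open import Data.Product using (_×_; _,_; ∃)
open import Data.Vec as Vec using (Vec; lookup)
open import Function using (_∘_; _on_)
open import Function.Bundles using (_⇔_; mk⇔; module Equivalence)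
open import Level using (_⊔_; 0ℓ)
open import Relation.Binary using (Rel)
open import Relation.Binary.PropositionalEquality using (_≡_)
open import Relation.Nullary using (Dec; ¬_)
open import Relation.Nullary.Decidable using (_×-dec_; _→-dec_; ¬?; map′)

module PowerSeries {c ℓ} (R : CommutativeRing c ℓ) where

  private
    open module R = CommutativeRing R using (Carrier; 0#; 1#)
    open import Algebra.Properties.Monoid.Sum R.+-monoid using (sum)
    open import Relation.Binary.Reasoning.Setoid R.setoid
    open import Algebra.Properties.CommutativeSemigroup R.+-commutativeSemigroup
      using (interchange)

  Series : Set c
  Series = ℕ → Carrier

  infix  4 _≈_
  infixl 6 _+_
  infixl 7 _*_
  infix  8 -_

  _≈_ : Rel Series ℓ
  f ≈ g = ∀ n → f n R.≈ g n

  _+_ _*_ : Series → Series → Series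
  (f + g) n = f n R.+ g n
  (f * g) n = sum {suc n} λ i → f (toℕ i) R.* g (n ∸ toℕ i)

  -_ : Series → Series
  (- f) n = R.- f n

  const : Carrier → Series
  const r zero    = r
  const r (suc _) = 0#

  X : Series
  X 1 = 1#
  X _ = 0#

  0S : Series
  0S _ = 0#

  1S : Series
  1S = const 1#

  private
    tail : Series → Series
    tail f n = f (suc n)

    scale : Carrier → Series → Series
    scale r f n = r R.* f n

  *-cong : ∀ {f f′ g g′} → f ≈ f′ → g ≈ g′ → f * g ≈ f′ * g′
  *-cong f≈ g≈ zero    = R.+-congʳ (R.*-cong (f≈ 0) (g≈ 0))
  *-cong f≈ g≈ (suc n) =
    R.+-cong (R.*-cong (f≈ 0) (g≈ (suc n))) (*-cong (f≈ ∘ suc) g≈ n)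

  *-zeroˡ : ∀ {f} g → f ≈ 0S → f * g ≈ 0S
  *-zeroˡ {f} g f≈0 zero = begin
    f 0 R.* g 0 R.+ 0#  ≈⟨ R.+-identityʳ _ ⟩
    f 0 R.* g 0         ≈⟨ R.*-congʳ (f≈0 0) ⟩
    0# R.* g 0          ≈⟨ R.zeroˡ _ ⟩
    0#                  ∎
  *-zeroˡ {f} g f≈0 (suc n) = begin
    f 0 R.* g (suc n) R.+ (tail f * g) n  ≈⟨ R.+-cong (R.*-congʳ (f≈0 0)) (*-zeroˡ g (f≈0 ∘ suc) n) ⟩
    0# R.* g (suc n) R.+ 0#               ≈⟨ R.+-identityʳ _ ⟩
    0# R.* g (suc n)                      ≈⟨ R.zeroˡ _ ⟩
    0#                                    ∎

  *-identityˡ : ∀ f → 1S * f ≈ f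
  *-identityˡ f zero    = R.trans (R.+-identityʳ _) (R.*-identityˡ _)
  *-identityˡ f (suc n) = begin
    1# R.* f (suc n) R.+ (tail 1S * f) n  ≈⟨ R.+-cong (R.*-identityˡ _) (*-zeroˡ f (λ _ → R.refl) n) ⟩
    f (suc n) R.+ 0#                      ≈⟨ R.+-identityʳ _ ⟩
    f (suc n)                             ∎

  *-distribʳ : ∀ h f g → (f + g) * h ≈ f * h + g * h
  *-distribʳ h f g zero = begin
    (f 0 R.+ g 0) R.* h 0 R.+ 0#                       ≈⟨ R.+-cong (R.distribʳ _ _ _) (R.sym (R.+-identityʳ 0#)) ⟩
    (f 0 R.* h 0 R.+ g 0 R.* h 0) R.+ (0# R.+ 0#)      ≈⟨ interchange _ _ _ _ ⟩
    (f 0 R.* h 0 R.+ 0#) R.+ (g 0 R.* h 0 R.+ 0#)      ∎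
  *-distribʳ h f g (suc n) = begin
    (f 0 R.+ g 0) R.* h (suc n) R.+ ((tail f + tail g) * h) n
      ≈⟨ R.+-cong (R.distribʳ _ _ _) (*-distribʳ h (tail f) (tail g) n) ⟩
    (f 0 R.* h (suc n) R.+ g 0 R.* h (suc n)) R.+ ((tail f * h) n R.+ (tail g * h) n)
      ≈⟨ interchange _ _ _ _ ⟩
    (f * h) (suc n) R.+ (g * h) (suc n) ∎

  private
    scale-* : ∀ r f g → scale r f * g ≈ scale r (f * g)
    scale-* r f g zero = begin
      (r R.* f 0) R.* g 0 R.+ 0#  ≈⟨ R.+-identityʳ _ ⟩
      (r R.* f 0) R.* g 0         ≈⟨ R.*-assoc _ _ _ ⟩
      r R.* (f 0 R.* g 0)         ≈⟨ R.*-congˡ (R.+-identityʳ _) ⟨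
      r R.* (f 0 R.* g 0 R.+ 0#)  ∎
    scale-* r f g (suc n) = begin
      (r R.* f 0) R.* g (suc n) R.+ (scale r (tail f) * g) n
        ≈⟨ R.+-cong (R.*-assoc _ _ _) (scale-* r (tail f) g n) ⟩
      r R.* (f 0 R.* g (suc n)) R.+ r R.* (tail f * g) n
        ≈⟨ R.distribˡ _ _ _ ⟨
      r R.* (f * g) (suc n) ∎

    *-sucʳ : ∀ f g n → (f * g) (suc n) R.≈ (f * tail g) n R.+ f (suc n) R.* g 0
    *-sucʳ f g zero = begin
      f 0 R.* g 1 R.+ (f 1 R.* g 0 R.+ 0#)  ≈⟨ R.+-congˡ (R.+-comm _ _) ⟩
      f 0 R.* g 1 R.+ (0# R.+ f 1 R.* g 0)  ≈⟨ R.+-assoc _ _ _ ⟨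
      (f 0 R.* g 1 R.+ 0#) R.+ f 1 R.* g 0  ∎
    *-sucʳ f g (suc n) = R.trans (R.+-congˡ (*-sucʳ (tail f) g n)) (R.sym (R.+-assoc _ _ _))

  *-comm : ∀ f g → f * g ≈ g * f
  *-comm f g zero    = R.+-congʳ (R.*-comm _ _)
  *-comm f g (suc n) = begin
    f 0 R.* g (suc n) R.+ (tail f * g) n  ≈⟨ R.+-cong (R.*-comm _ _) (*-comm (tail f) g n) ⟩
    g (suc n) R.* f 0 R.+ (g * tail f) n  ≈⟨ R.+-comm _ _ ⟩
    (g * tail f) n R.+ g (suc n) R.* f 0  ≈⟨ *-sucʳ g f n ⟨
    (g * f) (suc n)                       ∎

  *-assoc : ∀ f g h → (f * g) * h ≈ f * (g * h)
  *-assoc f g h zero = R.+-congʳ (begin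
    (f 0 R.* g 0 R.+ 0#) R.* h 0  ≈⟨ R.*-congʳ (R.+-identityʳ _) ⟩
    (f 0 R.* g 0) R.* h 0         ≈⟨ R.*-assoc _ _ _ ⟩
    f 0 R.* (g 0 R.* h 0)         ≈⟨ R.*-congˡ (R.+-identityʳ _) ⟨
    f 0 R.* (g 0 R.* h 0 R.+ 0#)  ∎)
  *-assoc f g h (suc n) = begin
    (f 0 R.* g 0 R.+ 0#) R.* h (suc n) R.+ ((scale (f 0) (tail g) + tail f * g) * h) n
      ≈⟨ R.+-cong (R.trans (R.*-congʳ (R.+-identityʳ _)) (R.*-assoc _ _ _))
                  (*-distribʳ h (scale (f 0) (tail g)) (tail f * g) n) ⟩
    f 0 R.* (g 0 R.* h (suc n)) R.+ ((scale (f 0) (tail g) * h) n R.+ ((tail f * g) * h) n)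
      ≈⟨ R.+-congˡ (R.+-cong (scale-* (f 0) (tail g) h n) (*-assoc (tail f) g h n)) ⟩
    f 0 R.* (g 0 R.* h (suc n)) R.+ (f 0 R.* (tail g * h) n R.+ (tail f * (g * h)) n)
      ≈⟨ R.+-assoc _ _ _ ⟨
    (f 0 R.* (g 0 R.* h (suc n)) R.+ f 0 R.* (tail g * h) n) R.+ (tail f * (g * h)) n
      ≈⟨ R.+-congʳ (R.distribˡ _ _ _) ⟨
    (f * (g * h)) (suc n) ∎

  +-isAbelianGroup : IsAbelianGroup _≈_ _+_ 0S -_
  +-isAbelianGroup = Pointwise.isAbelianGroup ℕ R.+-isAbelianGroup

  private
    *-identityʳ : ∀ f → f * 1S ≈ f
    *-identityʳ f n = R.trans (*-comm f 1S n) (*-identityˡ f n)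

    *-distribˡ : ∀ h f g → h * (f + g) ≈ h * f + h * g
    *-distribˡ h f g n = begin
      (h * (f + g)) n            ≈⟨ *-comm h (f + g) n ⟩
      ((f + g) * h) n            ≈⟨ *-distribʳ h f g n ⟩
      (f * h) n R.+ (g * h) n    ≈⟨ R.+-cong (*-comm f h n) (*-comm g h n) ⟩
      (h * f) n R.+ (h * g) n    ∎

  isCommutativeRing : IsCommutativeRing _≈_ _+_ _*_ -_ 0S 1S
  isCommutativeRing = record
    { isRing = record
      { +-isAbelianGroup = +-isAbelianGroup
      ; *-cong           = *-cong
      ; *-assoc          = *-assoc
      ; *-identity       = *-identityˡ , *-identityʳ
      ; distrib          = *-distribˡ , *-distribʳ
      }
    ; *-comm = *-comm
    }

  commutativeRing : CommutativeRing c ℓ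
  commutativeRing = record { isCommutativeRing = isCommutativeRing }

-- Polynomials as the power series with finitely many nonzero coefficients.
module Polynomials {c ℓ} (R : CommutativeRing c ℓ) where

  private
    open module R = CommutativeRing R using (Carrier; 0#; 1#)
    open import Algebra.Properties.Ring R.ring using (-0#≈0#)
    module S = PowerSeries R
    module SR = CommutativeRing S.commutativeRing

  record Polynomial : Set (c ⊔ ℓ) where
    constructor poly
    field
      coeff    : S.Series
      bound    : ℕ
      vanishes : ∀ {n} → bound ℕ.≤ n → coeff n R.≈ 0#

  open Polynomial public

  infix  4 _≈_
  infixl 6 _+_
  infixl 7 _*_
  infix  8 -_

  _≈_ : Rel Polynomial ℓ
  _≈_ = S._≈_ on coeff

  private
    *-vanishes : ∀ f g M N → (∀ {n} → M ℕ.≤ n → f n R.≈ 0#) → (∀ {n} → N ℕ.≤ n → g n R.≈ 0#) →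
                 ∀ {n} → M ℕ.+ N ℕ.≤ n → (f S.* g) n R.≈ 0#
    *-vanishes f g zero    N f≈0 g≈0 {n}     _           = S.*-zeroˡ g (λ i → f≈0 {i} z≤n) n
    *-vanishes f g (suc M) N f≈0 g≈0 {suc n} (s≤s M+N≤n) = R.trans
      (R.+-cong
        (R.trans (R.*-congˡ (g≈0 (ℕ.m≤n⇒m≤1+n (ℕ.≤-trans (ℕ.m≤n+m N M) M+N≤n)))) (R.zeroʳ _))
        (*-vanishes (f ∘ suc) g M N (f≈0 ∘ s≤s) g≈0 M+N≤n))
      (R.+-identityʳ 0#)

  _+_ _*_ : Polynomial → Polynomial → Polynomial
  poly f M f≈0 + poly g N g≈0 = poly (f S.+ g) (M ℕ.⊔ N) λ M⊔N≤n →
    R.trans (R.+-cong (f≈0 (ℕ.m⊔n≤o⇒m≤o M N M⊔N≤n)) (g≈0 (ℕ.m⊔n≤o⇒n≤o M N M⊔N≤n)))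
            (R.+-identityʳ 0#)
  poly f M f≈0 * poly g N g≈0 = poly (f S.* g) (M ℕ.+ N) (*-vanishes f g M N f≈0 g≈0)

  -_ : Polynomial → Polynomial
  - poly f M f≈0 = poly (S.- f) M λ M≤n → R.trans (R.-‿cong (f≈0 M≤n)) -0#≈0#

  const : Carrier → Polynomial
  const r = poly (S.const r) 1 λ { {suc _} _ → R.refl }

  X : Polynomial
  X = poly S.X 2 λ { {suc (suc _)} _ → R.refl ; {suc zero} (s≤s ()) }

  0P 1P : Polynomial
  0P = poly S.0S 0 λ _ → R.refl
  1P = const 1#

  isCommutativeRing : IsCommutativeRing _≈_ _+_ _*_ -_ 0P 1P
  isCommutativeRing = record
    { isRing = record
      { +-isAbelianGroup = record
        { isGroup = record
          { isMonoid = record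
            { isSemigroup = record
              { isMagma = record
                { isEquivalence = record { refl = SR.refl ; sym = SR.sym ; trans = SR.trans }
                ; ∙-cong        = SR.+-cong
                }
              ; assoc = λ f g h → SR.+-assoc (coeff f) (coeff g) (coeff h)
              }
            ; identity = (λ f → SR.+-identityˡ (coeff f)) , (λ f → SR.+-identityʳ (coeff f))
            }
          ; inverse = (λ f → SR.-‿inverseˡ (coeff f)) , (λ f → SR.-‿inverseʳ (coeff f))
          ; ⁻¹-cong = SR.-‿cong
          }
        ; comm = λ f g → SR.+-comm (coeff f) (coeff g)
        }
      ; *-cong     = SR.*-cong
      ; *-assoc    = λ f g h → SR.*-assoc (coeff f) (coeff g) (coeff h)
      ; *-identity = (λ f → SR.*-identityˡ (coeff f)) , (λ f → SR.*-identityʳ (coeff f))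
      ; distrib    = (λ f g h → SR.distribˡ (coeff f) (coeff g) (coeff h))
                   , (λ f g h → SR.distribʳ (coeff f) (coeff g) (coeff h))
      }
    ; *-comm = λ f g → SR.*-comm (coeff f) (coeff g)
    }

  commutativeRing : CommutativeRing (c ⊔ ℓ) ℓ
  commutativeRing = record { isCommutativeRing = isCommutativeRing }

-- A set partition of [n] with k blocks is given by its canonical sequential
-- form π : Vec (Fin k) n; the block with index j is { i | π i ≡ j }, so the
-- blocks are automatically disjoint and cover [n].  Letters and positions
-- are counted from 0 here.

module _ {k n} (π : Vec (Fin k) n) where

  IsMinOfBlock : Fin n → Fin k → Set
  IsMinOfBlock i j = lookup π i ≡ j × (∀ i′ → lookup π i′ ≡ j → i Fin.≤ i′)

  IsCanonical : Set
  IsCanonical =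
    (∀ j → ∃ λ i → lookup π i ≡ j) ×
    (∀ j j′ i i′ → j Fin.< j′ → IsMinOfBlock i j → IsMinOfBlock i′ j′ → i Fin.< i′)

  NonCrossing : Set
  NonCrossing = ∀ i₁ i₂ i₃ i₄ → i₁ Fin.< i₂ → i₂ Fin.< i₃ → i₃ Fin.< i₄ →
    ¬ (lookup π i₁ ≡ lookup π i₃ × lookup π i₂ ≡ lookup π i₄ × lookup π i₁ Fin.< lookup π i₂)

  isMinOfBlock? : ∀ i j → Dec (IsMinOfBlock i j)
  isMinOfBlock? i j =
    (lookup π i Fin.≟ j) ×-dec Fin.all? λ i′ → (lookup π i′ Fin.≟ j) →-dec (i Fin.≤? i′)

  isCanonical? : Dec IsCanonical
  isCanonical? =
    (Fin.all? λ j → Fin.any? λ i → lookup π i Fin.≟ j) ×-dec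
    (Fin.all? λ j → Fin.all? λ j′ → Fin.all? λ i → Fin.all? λ i′ →
      (j Fin.<? j′) →-dec isMinOfBlock? i j →-dec isMinOfBlock? i′ j′ →-dec (i Fin.<? i′))

  nonCrossing? : Dec NonCrossing
  nonCrossing? =
    Fin.all? λ i₁ → Fin.all? λ i₂ → Fin.all? λ i₃ → Fin.all? λ i₄ →
      (i₁ Fin.<? i₂) →-dec (i₂ Fin.<? i₃) →-dec (i₃ Fin.<? i₄) →-dec
      ¬? ((lookup π i₁ Fin.≟ lookup π i₃) ×-dec (lookup π i₂ Fin.≟ lookup π i₄)
          ×-dec (lookup π i₁ Fin.<? lookup π i₂))

Word : Set
Word = List ℕ

-- The letters 0, …, k - 1 become 1, …, k.
toWord : ∀ {k n} → Vec (Fin k) n → Word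
toWord = map (suc ∘ toℕ) ∘ Vec.toList

allVecs : ∀ k n → List (Vec (Fin k) n)
allVecs k zero    = [ Vec.[] ]
allVecs k (suc n) = cartesianProductWith Vec._∷_ (allFin k) (allVecs k n)

-- Every set partition of [n] has at most n blocks, so k ranges over 0, …, n.
NC : ℕ → List Word
NC n = concatMap
  (λ k → map toWord (filter (λ π → isCanonical? π ×-dec nonCrossing? π) (allVecs k n)))
  (upTo (suc n))

SameOrder : ℕ × ℕ → ℕ × ℕ → Set
SameOrder (u , v) (u′ , v′) = (u ℕ.< u′ ⇔ v ℕ.< v′) × (u ≡ u′ ⇔ v ≡ v′)

OrderIsomorphic : Word → Word → Set
OrderIsomorphic us vs =
  length us ≡ length vs × All (λ s → All (SameOrder s) (zip us vs)) (zip us vs)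

private
  _⇔-dec_ : ∀ {A B : Set} → Dec A → Dec B → Dec (A ⇔ B)
  a? ⇔-dec b? = map′ (λ (f , g) → mk⇔ f g) (λ e → Equivalence.to e , Equivalence.from e)
    ((a? →-dec b?) ×-dec (b? →-dec a?))

sameOrder? : ∀ s t → Dec (SameOrder s t)
sameOrder? (u , v) (u′ , v′) =
  ((u ℕ.<? u′) ⇔-dec (v ℕ.<? v′)) ×-dec ((u ℕ.≟ u′) ⇔-dec (v ℕ.≟ v′))

orderIsomorphic? : ∀ us vs → Dec (OrderIsomorphic us vs)
orderIsomorphic? us vs =
  (length us ℕ.≟ length vs) ×-dec All.all? (λ s → All.all? (sameOrder? s) (zip us vs)) (zip us vs)

-- The starting positions i are 0, …, length ρ - length τ, and there are none
-- when τ is longer than ρ.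
μ : Word → Word → ℕ
μ τ ρ = length (filter
  (λ i → orderIsomorphic? τ (take (length τ) (drop i ρ)))
  (upTo (suc (length ρ) ∸ length τ)))

ones ones-two : ℕ → Word
ones a     = replicate a 1
ones-two b = replicate b 1 ++ [ 2 ]

ℤ[p] ℤ[p,q] ℤ[p,q]⟦x⟧ : CommutativeRing 0ℓ 0ℓ
ℤ[p]      = Polynomials.commutativeRing ℤ-ring
ℤ[p,q]    = Polynomials.commutativeRing ℤ[p]
ℤ[p,q]⟦x⟧ = PowerSeries.commutativeRing ℤ[p,q]

module Coefficients where
  open CommutativeRing ℤ[p,q] public
  open import Algebra.Properties.Semiring.Exp semiring public using (_^_)

  p q : Carrier
  p = Polynomials.const ℤ[p] (Polynomials.X ℤ-ring)
  q = Polynomials.X ℤ[p]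

module GeneratingFunction where
  open CommutativeRing ℤ[p,q]⟦x⟧ public
  open import Algebra.Properties.Semiring.Exp semiring public using (_^_)

  p q x : Carrier
  p = PowerSeries.const ℤ[p,q] Coefficients.p
  q = PowerSeries.const ℤ[p,q] Coefficients.q
  x = PowerSeries.X ℤ[p,q]

  F : ℕ → ℕ → Carrier
  F a b n = foldr C._+_ C.0#
    (map (λ π → C.p C.^ μ (ones a) π C.* C.q C.^ μ (ones-two b) π) (NC n))
    where module C = Coefficients

{-# OPTIONS --safe #-}
-- The letters of a non-crossing canonical word that can still occur form a
-- stack: the next letter is either new, and is pushed, or is on the stack, and
-- everything above it is popped.  A maximal run of length j contributes
-- eⱼ = p^(j+1∸a), and another factor q if j ≥ b and the run is followed by an
-- ascent, so the weight of a word depends only on the heights of the stack.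
-- Let Φ h j be the series of the continuations of a run of length j on top of
-- h further letters.  Cutting a word at the first letter below a given height
-- shows that Φ (h + m) j = Φ h j · Sₘ, where Sₘ collects the empty word and the words
-- starting with one of m stack letters, so that S₁ = F.  Peeling off the first run then
-- yields (B - 1) F² = B F - E, where E = Σ eⱼ xʲ and B is E with a factor q on
-- the terms with j ≥ b; both become polynomials after multiplication by
-- (1 - x)(1 - p x).
module Submission where

open import Defs
open import Algebra.Bundles using (CommutativeRing)
open import Data.Integer as ℤ using (ℤ; +_; -[1+_])
import Data.Integer.Properties as ℤ
open import Data.List using (List; []; _∷_; [_]; _++_; length; replicate)
import Data.List.Properties as List
open import Data.List.Relation.Binary.Permutation.Propositional using (_↭_)
open import Data.List.Relation.Unary.All as All using (All; []; _∷_)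
open import Data.List.Relation.Unary.AllPairs using (AllPairs; []; _∷_)
open import Data.List.Relation.Unary.Any using (here; there)
open import Data.Maybe as Maybe using (Maybe)
open import Data.Nat as ℕ using (ℕ; zero; suc; _∸_; _≤_; _<_; z≤n; s≤s)
import Data.Nat.Properties as ℕ
open import Data.Product using (_×_; _,_; ∃; proj₁; proj₂)
open import Function using (_∘_)
open import Relation.Binary.PropositionalEquality as ≡ using (_≡_; _≢_)
open import Relation.Nullary using (¬_; Dec; yes; no; contradiction)
open import Relation.Nullary.Decidable using (dec⇒maybe; _×-dec_)

-- Generation of non-crossing canonical words by a stack.

module NonCrossingWords where

  open import Data.Fin as Fin using (Fin; zero; suc; toℕ; fromℕ<)
  import Data.Fin.Properties as Fin
  open import Data.List using (map; tabulate; filter; upTo)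
  open import Data.List.Membership.Propositional using (_∈_)
  open import Data.List.Membership.Propositional.Properties
  open import Data.List.Membership.Propositional.Properties.WithK using (unique∧set⇒bag)
  open import Data.List.Relation.Binary.BagAndSetEquality using (∼bag⇒↭)
  import Data.List.Relation.Unary.All.Properties as All
  import Data.List.Relation.Unary.AllPairs.Properties as AllPairs
  open import Data.List.Relation.Unary.Unique.Propositional using (Unique)
  import Data.List.Relation.Unary.Unique.Propositional.Properties as Unique
  open import Data.Nat using (pred; _>_)
  open import Data.Sum as Sum using (_⊎_; inj₁; inj₂)
  open import Data.Vec as Vec using (Vec; lookup)
  import Data.Vec.Functional as Vector
  import Data.Vec.Properties as Vec
  open import Function using (mk⇔)
  open import Relation.Binary using (tri<; tri≈; tri>)
  open ≡ using (refl; sym; trans; cong; cong₂; subst; subst₂)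

  -- The words continuing a non-crossing canonical prefix with m blocks, where
  -- the stack st lists, top first, the letters that can still occur.
  mutual
    continuations : List ℕ → ℕ → ℕ → List Word
    continuations st m zero    = [] ∷ []
    continuations st m (suc n) =
      map (suc m ∷_) (continuations (suc m ∷ st) (suc m) n) ++ pops st m n

    pops : List ℕ → ℕ → ℕ → List Word
    pops []       m n = []
    pops (c ∷ st) m n = map (c ∷_) (continuations (c ∷ st) m n) ++ pops st m n

  -- The sentinel `suc m` lets one sorted list say both that the letters decrease strictly from the
  -- top and that none exceeds `m`.
  Stack : List ℕ → ℕ → Set
  Stack st m = AllPairs _>_ (suc m ∷ st)

  private variable
    c k m n : ℕ
    st : List ℕ

  push : Stack st m → Stack (suc m ∷ st) (suc m)
  push (m>st ∷ sorted) = (ℕ.≤-refl ∷ All.map ℕ.m<n⇒m<1+n m>st) ∷ m>st ∷ sorted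

  pop : Stack (c ∷ st) m → Stack st m
  pop ((_ ∷ m>st) ∷ _ ∷ sorted) = m>st ∷ sorted

  below-top : ∀ {e} → Stack (c ∷ st) m → e ∈ st → e < c
  below-top (_ ∷ c>st ∷ _) e∈st = All.lookup c>st e∈st

  ≤-top : ∀ {e} → Stack (c ∷ st) m → e ∈ c ∷ st → e ≤ c
  ≤-top sorted (here refl)  = ℕ.≤-refl
  ≤-top sorted (there e∈st) = ℕ.<⇒≤ (below-top sorted e∈st)

  in-range : ∀ {e} → Stack st m → e ∈ st → e ≤ m
  in-range (m>st ∷ _) e∈st = ℕ.≤-pred (All.lookup m>st e∈st)

  -- Logical counterpart of `continuations`; words are functions on positions, so removing the first
  -- letter is composition with `suc`. In a canonical word every smaller letter precedes the first
  -- `b`, so avoiding `a b a b` amounts to avoiding `b a b` with `a < b`. This is `avoids`; `closed`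
  -- is the same condition when the initial `b` lies in the prefix.
  record Continuation (st : List ℕ) (m : ℕ) (f : Fin n → ℕ) : Set where
    field
      grows  : ∀ i {l} → m < l → l < f i → ∃ λ i′ → i′ Fin.< i × f i′ ≡ l
      opened : ∀ i → f i ≤ m → f i ∈ st
      closed : ∀ {e i j} → e ∈ st → i Fin.< j → f i < e → f j ≢ e
      avoids : ∀ {i j k} → i Fin.< j → j Fin.< k → f j < f i → f k ≢ f i

  open Continuation

  -- A pattern `b a b` starting with the new letter is excluded by `closed` for the new top; `push⁻`
  -- reads this exchange backwards.
  push⁺ : {f : Fin n → ℕ} → Stack st m → Continuation (suc m ∷ st) (suc m) f →
          Continuation st m (suc m Vector.∷ f)
  push⁺ {m = m} {f} sorted C = record
    { grows  = grows′
    ; opened = λ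
        { zero    m<m  → contradiction m<m ℕ.1+n≰n
        ; (suc i) fi≤m → opened′ fi≤m (opened C i (ℕ.m≤n⇒m≤1+n fi≤m)) }
    ; closed = λ
        { {i = zero}  {suc j} e∈st _ m<e     → contradiction (in-range sorted e∈st) (ℕ.<⇒≱ (ℕ.<⇒≤ m<e))
        ; {i = suc i} {suc j} e∈st (s≤s i<j) → closed C (there e∈st) i<j }
    ; avoids = λ
        { {zero}  {suc j} {suc k} _         (s≤s j<k) → closed C (here refl) j<k
        ; {suc i} {suc j} {suc k} (s≤s i<j) (s≤s j<k) → avoids C i<j j<k }
    }
    where
    grows′ : ∀ i {l} → m < l → l < (suc m Vector.∷ f) i → ∃ λ i′ → i′ Fin.< i × (suc m Vector.∷ f) i′ ≡ l
    grows′ zero    m<l (s≤s l≤m) = contradiction l≤m (ℕ.<⇒≱ m<l)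
    grows′ (suc i) m<l l<fi with ℕ.m≤n⇒m<n∨m≡n m<l
    ... | inj₂ m≡l = zero , s≤s z≤n , m≡l
    ... | inj₁ m<l′ = let i′ , i′<i , eq = grows C i m<l′ l<fi in suc i′ , s≤s i′<i , eq
    opened′ : ∀ {e} → e ≤ m → e ∈ suc m ∷ _ → e ∈ _
    opened′ m<m (here refl)  = contradiction m<m ℕ.1+n≰n
    opened′ _   (there e∈st) = e∈st

  push⁻ : {f : Fin (suc n) → ℕ} → f zero ≡ suc m → Continuation st m f →
          Continuation (suc m ∷ st) (suc m) (f ∘ suc)
  push⁻ {m = m} {f = f} f0 C = record
    { grows  = grows′
    ; opened = opened′
    ; closed = λ
        { {i = i} (here refl) i<j fi<m fj≡m →
            avoids C (s≤s z≤n) (s≤s i<j) (subst (f (suc i) <_) (sym f0) fi<m) (trans fj≡m (sym f0))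
        ; (there e∈st) i<j → closed C e∈st (s≤s i<j) }
    ; avoids = λ i<j j<k → avoids C (s≤s i<j) (s≤s j<k)
    }
    where
    grows′ : ∀ i {l} → suc m < l → l < f (suc i) → ∃ λ i′ → i′ Fin.< i × f (suc i′) ≡ l
    grows′ i m<l l<fi with grows C (suc i) (ℕ.<-trans ℕ.≤-refl m<l) l<fi
    ... | zero   , _          , f0≡l = contradiction (trans (sym f0) f0≡l) (ℕ.<⇒≢ m<l)
    ... | suc i′ , s≤s i′<i , eq   = i′ , i′<i , eq
    opened′ : ∀ i → f (suc i) ≤ suc m → f (suc i) ∈ suc m ∷ _
    opened′ i fi≤m with ℕ.m≤n⇒m<n∨m≡n fi≤m
    ... | inj₁ (s≤s fi≤m′) = there (opened C (suc i) fi≤m′)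
    ... | inj₂ fi≡m        = here fi≡m

  pop⁺ : {f : Fin n → ℕ} → Stack (c ∷ st) m → Continuation (c ∷ st) m f →
         Continuation (c ∷ st) m (c Vector.∷ f)
  pop⁺ {c = c} {m = m} {f} sorted C = record
    { grows  = grows′
    ; opened = λ { zero _ → here refl ; (suc i) → opened C i }
    ; closed = λ
        { {i = zero}  {suc j} e∈st _ c<e     → contradiction (≤-top sorted e∈st) (ℕ.<⇒≱ c<e)
        ; {i = suc i} {suc j} e∈st (s≤s i<j) → closed C e∈st i<j }
    ; avoids = λ
        { {zero}  {suc j} {suc k} _         (s≤s j<k) → closed C (here refl) j<k
        ; {suc i} {suc j} {suc k} (s≤s i<j) (s≤s j<k) → avoids C i<j j<k }
    }
    where
    grows′ : ∀ i {l} → m < l → l < (c Vector.∷ f) i → ∃ λ i′ → i′ Fin.< i × (c Vector.∷ f) i′ ≡ l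
    grows′ zero    m<l l<c = contradiction (ℕ.<-trans m<l l<c) (ℕ.≤⇒≯ (in-range sorted (here refl)))
    grows′ (suc i) m<l l<fi = let i′ , i′<i , eq = grows C i m<l l<fi in suc i′ , s≤s i′<i , eq

  -- A word continuing the smaller stack never contains `c`: its letters up to `m` lie in `st`, and
  -- those are all below `c`.
  weaken : {f : Fin n → ℕ} → Stack (c ∷ st) m → Continuation st m f → Continuation (c ∷ st) m f
  weaken sorted C = record
    { grows  = grows C
    ; opened = λ i fi≤m → there (opened C i fi≤m)
    ; closed = λ
        { (here refl)  i<j fi<c fj≡c → ℕ.<⇒≢ (below-top sorted
            (opened C _ (subst (_≤ _) (sym fj≡c) (in-range sorted (here refl))))) fj≡c
        ; (there e∈st) → closed C e∈st }
    ; avoids = avoids C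
    }

  pop⁻ : {f : Fin (suc n) → ℕ} → Stack (f zero ∷ st) m → Continuation (f zero ∷ st) m f →
         Continuation (f zero ∷ st) m (f ∘ suc)
  pop⁻ {m = m} {f = f} sorted C = record
    { grows  = grows′
    ; opened = opened C ∘ suc
    ; closed = λ e∈st i<j → closed C e∈st (s≤s i<j)
    ; avoids = λ i<j j<k → avoids C (s≤s i<j) (s≤s j<k)
    }
    where
    grows′ : ∀ i {l} → m < l → l < f (suc i) → ∃ λ i′ → i′ Fin.< i × f (suc i′) ≡ l
    grows′ i m<l l<fi with grows C (suc i) m<l l<fi
    ... | zero   , _        , f0≡l =
      contradiction (subst (_≤ m) f0≡l (in-range sorted (here refl))) (ℕ.<⇒≱ m<l)
    ... | suc i′ , s≤s i′<i , eq   = i′ , i′<i , eq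

  -- The first letter is below `c`, so `closed` forbids every later `c` and `c` can leave the stack.
  shrink : {f : Fin (suc n) → ℕ} → Stack (c ∷ st) m → f zero ∈ st → Continuation (c ∷ st) m f →
           Continuation st m f
  shrink {m = m} {f = f} sorted f0∈st C = record
    { grows  = grows C
    ; opened = opened′
    ; closed = closed C ∘ there
    ; avoids = avoids C
    }
    where
    opened′ : ∀ i → f i ≤ m → f i ∈ _
    opened′ zero    _ = f0∈st
    opened′ (suc i) fi≤m with opened C (suc i) fi≤m
    ... | here fi≡c   = contradiction fi≡c (closed C (here refl) (s≤s z≤n) (below-top sorted f0∈st))
    ... | there fi∈st = fi∈st

  mutual
    continuations-sound : ∀ {w} n → Stack st m → w ∈ continuations st m n →
      ∃ λ (f : Fin n → ℕ) → w ≡ tabulate f × Continuation st m f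
    continuations-sound zero sorted (here refl) = (λ ()) , refl , record
      { grows = λ () ; opened = λ () ; closed = λ { {i = ()} } ; avoids = λ { {()} } }
    continuations-sound {st} {m} (suc n) sorted w∈
      with ∈-++⁻ (map (suc m ∷_) (continuations (suc m ∷ st) (suc m) n)) w∈
    ... | inj₂ w∈pops = pops-sound n sorted w∈pops
    ... | inj₁ w∈push with ∈-map⁻ (suc m ∷_) w∈push
    ... | v , v∈ , refl =
      let f , eq , C = continuations-sound n (push sorted) v∈
      in suc m Vector.∷ f , cong (suc m ∷_) eq , push⁺ sorted C

    pops-sound : ∀ {w} n → Stack st m → w ∈ pops st m n →
      ∃ λ (f : Fin (suc n) → ℕ) → w ≡ tabulate f × Continuation st m f
    pops-sound {c ∷ st} {m} n sorted w∈ with ∈-++⁻ (map (c ∷_) (continuations (c ∷ st) m n)) w∈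
    ... | inj₂ w∈pops =
      let f , eq , C = pops-sound n (pop sorted) w∈pops
      in f , eq , weaken sorted C
    ... | inj₁ w∈top with ∈-map⁻ (c ∷_) w∈top
    ... | v , v∈ , refl =
      let f , eq , C = continuations-sound n sorted v∈
      in c Vector.∷ f , cong (c ∷_) eq , pop⁺ sorted C

  mutual
    continuations-complete : ∀ n {f : Fin n → ℕ} → Stack st m → Continuation st m f →
      tabulate f ∈ continuations st m n
    continuations-complete zero    sorted C = here refl
    continuations-complete {st} {m} (suc n) {f} sorted C with ℕ.<-cmp (f zero) (suc m)
    ... | tri< (s≤s f0≤m) _ _ =
      ∈-++⁺ʳ _ (pops-complete n sorted (opened C zero f0≤m) C)
    -- A first letter above `suc m` would require `suc m` at a still earlier position.
    ... | tri> _ _ m<f0 with () ← proj₁ (proj₂ (grows C zero ℕ.≤-refl m<f0))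
    ... | tri≈ _ f0≡m _ = ∈-++⁺ˡ (subst
      (λ c → c ∷ tabulate (f ∘ suc) ∈ map (suc m ∷_) (continuations (suc m ∷ st) (suc m) n)) (sym f0≡m)
      (∈-map⁺ (suc m ∷_) (continuations-complete n (push sorted) (push⁻ f0≡m C))))

    pops-complete : ∀ n {f : Fin (suc n) → ℕ} → Stack st m → f zero ∈ st → Continuation st m f →
      tabulate f ∈ pops st m n
    pops-complete n {f} sorted (here refl) C =
      ∈-++⁺ˡ (∈-map⁺ (f zero ∷_) (continuations-complete n sorted (pop⁻ sorted C)))
    pops-complete n sorted (there f0∈st) C =
      ∈-++⁺ʳ _ (pops-complete n (pop sorted) f0∈st (shrink sorted f0∈st C))

  head∈-pops : ∀ {w} n → w ∈ pops st m n → ∃ λ c → c ∈ st × ∃ λ v → w ≡ c ∷ v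
  head∈-pops {c ∷ st} {m} n w∈ with ∈-++⁻ (map (c ∷_) (continuations (c ∷ st) m n)) w∈
  ... | inj₁ w∈top  = let v , _ , eq = ∈-map⁻ (c ∷_) w∈top in c , here refl , v , eq
  ... | inj₂ w∈pops = let d , d∈ , rest = head∈-pops n w∈pops in d , there d∈ , rest

  mutual
    -- First letters separate the branches: a pushed letter exceeds the whole stack, and popping
    -- deeper yields a smaller letter.
    continuations-unique : ∀ n → Stack st m → Unique (continuations st m n)
    continuations-unique zero    sorted = [] ∷ []
    continuations-unique {st} {m} (suc n) sorted = Unique.++⁺
      (Unique.map⁺ List.∷-injectiveʳ (continuations-unique n (push sorted)))
      (pops-unique n sorted)
      λ (w∈push , w∈pops) →
        let _ , _  , eq      = ∈-map⁻ (suc m ∷_) w∈push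
            d , d∈ , _ , eq′ = head∈-pops n w∈pops
        in ℕ.<⇒≢ (s≤s (in-range sorted d∈)) (List.∷-injectiveˡ (trans (sym eq′) eq))

    pops-unique : ∀ n → Stack st m → Unique (pops st m n)
    pops-unique {[]}     n sorted = []
    pops-unique {c ∷ st} n sorted = Unique.++⁺
      (Unique.map⁺ List.∷-injectiveʳ (continuations-unique n sorted))
      (pops-unique n (pop sorted))
      λ (w∈top , w∈pops) →
        let _ , _  , eq      = ∈-map⁻ (c ∷_) w∈top
            d , d∈ , _ , eq′ = head∈-pops n w∈pops
        in ℕ.<⇒≢ (below-top sorted d∈) (List.∷-injectiveˡ (trans (sym eq′) eq))

  -- Canonical sequential forms as continuations of the empty prefix.

  letters : Vec (Fin k) n → Fin n → ℕ
  letters π i = suc (toℕ (lookup π i))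

  toWord-tabulate : (π : Vec (Fin k) n) → toWord π ≡ tabulate (letters π)
  toWord-tabulate Vec.[]      = refl
  toWord-tabulate (c Vec.∷ π) = cong (suc (toℕ c) ∷_) (toWord-tabulate π)

  letters-injective : (π : Vec (Fin k) n) → ∀ {i j} →
    letters π i ≡ letters π j → lookup π i ≡ lookup π j
  letters-injective π = Fin.toℕ-injective ∘ ℕ.suc-injective

  first : {P : Fin n → Set} → (∀ i → Dec (P i)) → ∀ {i} → P i →
    ∃ λ i₀ → P i₀ × (∀ i′ → P i′ → i₀ Fin.≤ i′)
  first {n = suc n} P? {i} p with P? zero
  first {n = suc n} P? {i}     p | yes p₀ = zero , p₀ , λ _ _ → z≤n
  first {n = suc n} P? {zero}  p | no ¬p₀ = contradiction p ¬p₀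
  first {n = suc n} P? {suc i} p | no ¬p₀ =
    let i₀ , pᵢ , least = first (P? ∘ suc) p
    in suc i₀ , pᵢ , λ { zero p₀ → contradiction p₀ ¬p₀ ; (suc i′) p′ → s≤s (least i′ p′) }

  -- The minimum of the block of `j` precedes the minimum of the block of `lookup π i`, which is at
  -- most `i`. This local form of the order of the blocks is what `Continuation` records.
  canonical-grows : (π : Vec (Fin k) n) → IsCanonical π →
    ∀ i {j} → j Fin.< lookup π i → ∃ λ i′ → i′ Fin.< i × lookup π i′ ≡ j
  canonical-grows π (onto , ordered) i {j} j<πi =
    let i₁ , πi₁≡j  , min₁ = first (λ i′ → lookup π i′ Fin.≟ j) (proj₂ (onto j))
        i₂ , πi₂≡πi , min₂ = first (λ i′ → lookup π i′ Fin.≟ lookup π i) {i} refl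
        i₁<i₂ = ordered j (lookup π i) i₁ i₂ j<πi (πi₁≡j , min₁) (πi₂≡πi , min₂)
    in i₁ , ℕ.<-≤-trans i₁<i₂ (min₂ i refl) , πi₁≡j

  grows-canonical : (π : Vec (Fin k) n) → (∀ j → ∃ λ i → lookup π i ≡ j) →
    (∀ i {j} → j Fin.< lookup π i → ∃ λ i′ → i′ Fin.< i × lookup π i′ ≡ j) → IsCanonical π
  grows-canonical π onto grows = onto , λ j j′ i i′ j<j′ (_ , min) (πi′≡j′ , _) →
    let i″ , i″<i′ , πi″≡j = grows i′ (subst (j Fin.<_) (sym πi′≡j′) j<j′)
    in ℕ.≤-<-trans (min i″ πi″≡j) i″<i′

  canonical⇒continuation : (π : Vec (Fin k) n) → IsCanonical π → NonCrossing π →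
    Continuation [] 0 (letters π)
  canonical⇒continuation {k} π canonical noncrossing = record
    { grows  = λ { i {suc l} _ (s≤s l<πi) →
        let l<k = ℕ.<-trans l<πi (Fin.toℕ<n (lookup π i))
            toℕ≡l = Fin.toℕ-fromℕ< l<k
            i′ , i′<i , eq = canonical-grows π canonical i {fromℕ< l<k}
              (subst (_< toℕ (lookup π i)) (sym toℕ≡l) l<πi)
        in i′ , i′<i , cong suc (trans (cong toℕ eq) toℕ≡l) }
    ; opened = λ i ()
    ; closed = λ ()
    ; avoids = λ { {i} {j} {l} i<j j<l (s≤s πj<πi) πl≡πi →
        -- An earlier occurrence of the smaller letter extends `b a b` to a crossing `a b a b`.
        let i′ , i′<i , eq = canonical-grows π canonical i πj<πi
        in noncrossing i′ i j l i′<i i<j j<l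
             (eq , sym (letters-injective π πl≡πi) , subst (Fin._< lookup π i) (sym eq) πj<πi) }
    }

  continuation⇒noncrossing : (π : Vec (Fin k) n) → Continuation [] 0 (letters π) → NonCrossing π
  continuation⇒noncrossing π C i₁ i₂ i₃ i₄ i₁<i₂ i₂<i₃ i₃<i₄ (π₁≡π₃ , π₂≡π₄ , π₁<π₂) =
    avoids C i₂<i₃ i₃<i₄ (s≤s (subst (Fin._< lookup π i₂) π₁≡π₃ π₁<π₂)) (cong (suc ∘ toℕ) (sym π₂≡π₄))

  maximum : (f : Fin n → ℕ) → ∃ λ k → (∀ i → f i ≤ k) × (k ≡ 0 ⊎ ∃ λ i → f i ≡ k)
  maximum {zero}  f = 0 , (λ ()) , inj₁ refl
  maximum {suc n} f with maximum (f ∘ suc)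
  ... | k , f≤k , attained with ℕ.≤-total (f zero) k
  ...   | inj₁ f0≤k =
    k , (λ { zero → f0≤k ; (suc i) → f≤k i }) , Sum.map₂ (λ (i , eq) → suc i , eq) attained
  ...   | inj₂ k≤f0 =
    f zero , (λ { zero → ℕ.≤-refl ; (suc i) → ℕ.≤-trans (f≤k i) k≤f0 }) , inj₂ (zero , refl)

  -- The number of blocks is the largest letter; `grows` supplies all smaller ones, so no block is
  -- empty.
  continuation⇒canonical : (f : Fin n → ℕ) → Continuation [] 0 f →
    ∃ λ k → ∃ λ (π : Vec (Fin k) n) → (∀ i → letters π i ≡ f i) × IsCanonical π
  continuation⇒canonical {n} f C with maximum f
  ... | k , f≤k , attained = k , π , letters≡f , grows-canonical π (onto attained) grows′
    where
    pred< : ∀ i → pred (f i) < k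
    pred< i with f i | f≤k i | opened C i
    -- A letter zero would have to lie on the empty stack, so `pred` never truncates.
    ... | zero  | _   | ∈[] with () ← ∈[] z≤n
    ... | suc _ | l<k | _ = l<k

    π : Vec (Fin k) n
    π = Vec.tabulate (λ i → fromℕ< (pred< i))

    letters≡f : ∀ i → letters π i ≡ f i
    letters≡f i
      rewrite Vec.lookup∘tabulate (λ i → fromℕ< (pred< i)) i | Fin.toℕ-fromℕ< (pred< i)
      with f i | opened C i
    ... | zero  | ∈[] with () ← ∈[] z≤n
    ... | suc _ | _   = refl

    lookup≡ : ∀ {i j} → f i ≡ suc (toℕ j) → lookup π i ≡ j
    lookup≡ {i} eq = Fin.toℕ-injective (ℕ.suc-injective (trans (letters≡f i) eq))

    grows′ : ∀ i {j} → j Fin.< lookup π i → ∃ λ i′ → i′ Fin.< i × lookup π i′ ≡ j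
    grows′ i {j} j<πi =
      let j<fi = subst (suc (toℕ j) <_) (letters≡f i) (s≤s j<πi)
          i′ , i′<i , eq = grows C i {suc (toℕ j)} (s≤s z≤n) j<fi
      in i′ , i′<i , lookup≡ eq

    onto : k ≡ 0 ⊎ (∃ λ i → f i ≡ k) → ∀ j → ∃ λ i → lookup π i ≡ j
    onto (inj₁ k≡0)        j with () ← subst Fin k≡0 j
    onto (inj₂ (i , fi≡k)) j with ℕ.m≤n⇒m<n∨m≡n (Fin.toℕ<n j)
    ... | inj₂ j≡k = i , lookup≡ (trans fi≡k (sym j≡k))
    ... | inj₁ j<k =
      let i′ , _ , eq = grows C i {suc (toℕ j)} (s≤s z≤n) (subst (suc (toℕ j) <_) (sym fi≡k) j<k)
      in i′ , lookup≡ eq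

  -- Choosing a position in each block is injective. The bound places `k` in the range of block
  -- numbers that `NC n` runs through.
  onto⇒≤ : (π : Vec (Fin k) n) → (∀ j → ∃ λ i → lookup π i ≡ j) → k ≤ n
  onto⇒≤ π onto = Fin.injective⇒≤ {f = proj₁ ∘ onto} λ {j} {j′} eq →
    trans (sym (proj₂ (onto j))) (trans (cong (lookup π) eq) (proj₂ (onto j′)))

  -- The list `NC n` as a rearrangement of the continuations.

  ∈-allVecs : (π : Vec (Fin k) n) → π ∈ allVecs k n
  ∈-allVecs Vec.[]      = here refl
  ∈-allVecs (c Vec.∷ π) = ∈-cartesianProductWith⁺ Vec._∷_ (∈-allFin c) (∈-allVecs π)

  allVecs-unique : ∀ k n → Unique (allVecs k n)
  allVecs-unique k zero    = [] ∷ []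
  allVecs-unique k (suc n) = Unique.cartesianProductWith⁺ Vec._∷_ Vec.∷-injective
    (Unique.allFin⁺ k) (allVecs-unique k n)

  toWord-injective : {π ρ : Vec (Fin k) n} → toWord π ≡ toWord ρ → π ≡ ρ
  toWord-injective {π = Vec.[]}    {Vec.[]}    _  = refl
  toWord-injective {π = c Vec.∷ π} {d Vec.∷ ρ} eq = cong₂ Vec._∷_
    (Fin.toℕ-injective (ℕ.suc-injective (List.∷-injectiveˡ eq)))
    (toWord-injective (List.∷-injectiveʳ eq))

  IsNC : ∀ k n → Word → Set
  IsNC k n w = ∃ λ (π : Vec (Fin k) n) → w ≡ toWord π × IsCanonical π × NonCrossing π

  isNC? : (π : Vec (Fin k) n) → Dec (IsCanonical π × NonCrossing π)
  isNC? π = isCanonical? π ×-dec nonCrossing? π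

  NC-block : ℕ → ℕ → List Word
  NC-block n k = map toWord (filter isNC? (allVecs k n))

  ∈-NC-block⁻ : ∀ {w} k → w ∈ NC-block n k → IsNC k n w
  ∈-NC-block⁻ {n} k w∈ with ∈-map⁻ toWord w∈
  ... | π , π∈ , eq = π , eq , proj₂ (∈-filter⁻ isNC? {xs = allVecs k n} π∈)

  ∈-NC⁺ : (π : Vec (Fin k) n) → IsCanonical π → NonCrossing π → toWord π ∈ NC n
  ∈-NC⁺ {k} {n} π canonical noncrossing = ∈-concat⁺′
    (∈-map⁺ toWord (∈-filter⁺ isNC? (∈-allVecs π) (canonical , noncrossing)))
    (∈-map⁺ (NC-block n) (∈-upTo⁺ (s≤s (onto⇒≤ π (proj₁ canonical)))))

  ∈-NC⁻ : ∀ {w} n → w ∈ NC n → ∃ λ k → IsNC k n w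
  ∈-NC⁻ n w∈ with ∈-concat⁻′ (map (NC-block n) (upTo (suc n))) w∈
  ... | ws , w∈ws , ws∈ with ∈-map⁻ (NC-block n) ws∈
  ... | k , _ , refl = k , ∈-NC-block⁻ k w∈ws

  -- The largest letter of a word with `k′` blocks does not occur in one with `k` blocks.
  IsNC-blocks : ∀ {k k′ w} → k < k′ → IsNC k n w → ¬ IsNC k′ n w
  IsNC-blocks {k = k} (s≤s {n = l} k≤l) (π , refl , _) (ρ , eq , (onto , _) , _) =
    let i , ρi≡l = onto (Fin.fromℕ l)
        π≡ρ = trans (sym (toWord-tabulate π)) (trans eq (toWord-tabulate ρ))
        i′ , eq′ = ∈-tabulate⁻ {f = letters π} (subst (letters ρ i ∈_) (sym π≡ρ) (∈-tabulate⁺ i))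
        l≡πi′ = trans (sym (Fin.toℕ-fromℕ l)) (trans (cong toℕ (sym ρi≡l)) (ℕ.suc-injective eq′))
    in ℕ.<⇒≱ (subst (_< k) (sym l≡πi′) (Fin.toℕ<n (lookup π i′))) k≤l

  NC-unique : ∀ n → Unique (NC n)
  NC-unique n = Unique.concat⁺
    (All.map⁺ (All.universal
      (λ k → Unique.map⁺ toWord-injective (Unique.filter⁺ isNC? (allVecs-unique k n))) (upTo (suc n))))
    (AllPairs.map⁺ (AllPairs.applyUpTo⁺₁ (λ k → k) (suc n) λ {k} {k′} k<k′ _ (w∈ , w∈′) →
      IsNC-blocks k<k′ (∈-NC-block⁻ k w∈) (∈-NC-block⁻ k′ w∈′)))

  Continuation-resp : ∀ {st m} {f g : Fin n → ℕ} → (∀ i → g i ≡ f i) →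
    Continuation st m f → Continuation st m g
  Continuation-resp {st = st} {m} {f} {g} g≡f C = record
    { grows  = λ i {l} m<l l<gi →
        let i′ , i′<i , eq = grows C i m<l (subst (l <_) (g≡f i) l<gi) in i′ , i′<i , trans (g≡f i′) eq
    ; opened = λ i gi≤m → subst (_∈ st) (sym (g≡f i)) (opened C i (subst (_≤ m) (g≡f i) gi≤m))
    ; closed = λ {e} {i} {j} e∈st i<j gi<e gj≡e →
        closed C e∈st i<j (subst (_< e) (g≡f i) gi<e) (trans (sym (g≡f j)) gj≡e)
    ; avoids = λ {i} {j} {k} i<j j<k gj<gi gk≡gi →
        avoids C i<j j<k (subst₂ _<_ (g≡f j) (g≡f i) gj<gi) (trans (sym (g≡f k)) (trans gk≡gi (g≡f i)))
    }

  -- Both lists are free of repetitions and have the same members. Only a permutation can be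
  -- expected, since `NC n` is grouped by the number of blocks.
  NC↭continuations : ∀ n → NC n ↭ continuations [] 0 n
  NC↭continuations n =
    ∼bag⇒↭ (unique∧set⇒bag (NC-unique n) (continuations-unique n ([] ∷ [])) (mk⇔ to from))
    where
    to : ∀ {w} → w ∈ NC n → w ∈ continuations [] 0 n
    to w∈ =
      let k , π , eq , canonical , noncrossing = ∈-NC⁻ n w∈
          C = canonical⇒continuation π canonical noncrossing
      in subst (_∈ continuations [] 0 n) (sym (trans eq (toWord-tabulate π)))
           (continuations-complete n ([] ∷ []) C)

    from : ∀ {w} → w ∈ continuations [] 0 n → w ∈ NC n
    from w∈ =
      let f , eq , C = continuations-sound n ([] ∷ []) w∈
          k , π , letters≡f , canonical = continuation⇒canonical f C
          noncrossing = continuation⇒noncrossing π (Continuation-resp letters≡f C)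
          f≡π = trans (List.tabulate-cong (sym ∘ letters≡f)) (sym (toWord-tabulate π))
      in subst (_∈ NC n) (sym (trans eq f≡π)) (∈-NC⁺ π canonical noncrossing)

-- The indicator of `b ≤ j`, as a number that can serve as an exponent of `q`. Its recursion makes
-- `jump (suc b) f ∘ suc` reduce to `jump b (f ∘ suc)`.
reached : ℕ → ℕ → ℕ
reached zero    _       = 1
reached (suc _) zero    = 0
reached (suc b) (suc j) = reached b j

reached-≤ : ∀ {b j} → b ≤ j → reached b j ≡ 1
reached-≤ z≤n       = ≡.refl
reached-≤ (s≤s b≤j) = reached-≤ b≤j

reached-> : ∀ {b j} → j < b → reached b j ≡ 0
reached-> {suc b} {zero}  _         = ≡.refl
reached-> {suc b} {suc j} (s≤s j<b) = reached-> j<b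

-- Occurrences of the two subwords that start in a maximal run.

module Occurrences where

  open import Data.List using (map; take; drop; zip; filter; upTo)
  open import Data.List.Membership.Propositional using (_∈_)
  open import Function using (_⇔_; mk⇔; Equivalence)
  open import Relation.Binary using (tri<; tri≈; tri>)
  open import Relation.Unary using (Decidable)
  open ≡ using (refl; sym; trans; cong; subst; subst₂; module ≡-Reasoning)

  length-filter-map : ∀ {A B : Set} {P : B → Set} (P? : Decidable P) (f : A → B) xs →
    length (filter P? (map f xs)) ≡ length (filter (P? ∘ f) xs)
  length-filter-map P? f [] = refl
  length-filter-map P? f (x ∷ xs) with P? (f x)
  ... | yes _ = cong suc (length-filter-map P? f xs)
  ... | no  _ = length-filter-map P? f xs

  StartsLike : Word → Word → Set
  StartsLike τ ρ = OrderIsomorphic τ (take (length τ) ρ)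

  StartsLike⇒≤ : ∀ {τ} ρ → StartsLike τ ρ → length τ ≤ length ρ
  StartsLike⇒≤ {τ} ρ (eq , _) = subst (_≤ length ρ)
    (trans (sym (List.length-take (length τ) ρ)) (sym eq)) (ℕ.m⊓n≤n (length τ) (length ρ))

  short-mismatch : ∀ {τ} ρ → length ρ < length τ → ¬ StartsLike τ ρ
  short-mismatch ρ ρ<τ starts = ℕ.<⇒≱ ρ<τ (StartsLike⇒≤ ρ starts)

  module _ (τ : Word) (c : ℕ) (ρ : Word) where

    private
      occurs? : ∀ i → Dec (StartsLike τ (drop i (c ∷ ρ)))
      occurs? i = orderIsomorphic? τ (take (length τ) (drop i (c ∷ ρ)))

      later : List ℕ
      later = map suc (upTo (suc (length ρ) ∸ length τ))

      positions : length τ ≤ suc (length ρ) → upTo (suc (suc (length ρ)) ∸ length τ) ≡ 0 ∷ later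
      positions τ≤ρ = trans (cong upTo (ℕ.+-∸-assoc 1 τ≤ρ)) (cong (0 ∷_) (sym (List.map-upTo suc _)))

      count-later : length (filter occurs? later) ≡ μ τ ρ
      count-later = length-filter-map occurs? suc (upTo (suc (length ρ) ∸ length τ))

    -- Together with `μ-mismatch` this computes `μ` letter by letter: only position zero is new, the
    -- others are positions of the tail shifted by one.
    μ-match : StartsLike τ (c ∷ ρ) → μ τ (c ∷ ρ) ≡ suc (μ τ ρ)
    μ-match starts = begin
      μ τ (c ∷ ρ)                          ≡⟨ cong (length ∘ filter occurs?) (positions (StartsLike⇒≤ (c ∷ ρ) starts)) ⟩
      length (filter occurs? (0 ∷ later))  ≡⟨ cong length (List.filter-accept occurs? {0} {later} starts) ⟩
      suc (length (filter occurs? later))  ≡⟨ cong suc count-later ⟩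
      suc (μ τ ρ)                          ∎
      where open ≡-Reasoning

    μ-mismatch : ¬ StartsLike τ (c ∷ ρ) → μ τ (c ∷ ρ) ≡ μ τ ρ
    μ-mismatch ¬starts with length τ ℕ.≤? suc (length ρ)
    ... | yes τ≤ρ = begin
      μ τ (c ∷ ρ)                          ≡⟨ cong (length ∘ filter occurs?) (positions τ≤ρ) ⟩
      length (filter occurs? (0 ∷ later))  ≡⟨ cong length (List.filter-reject occurs? {0} {later} ¬starts) ⟩
      length (filter occurs? later)        ≡⟨ count-later ⟩
      μ τ ρ                                ∎
      where open ≡-Reasoning
    -- The pattern is longer than the word: both truncated differences vanish and no position is
    -- tested.
    ... | no τ≰ρ
      rewrite ℕ.m≤n⇒m∸n≡0 {suc (suc (length ρ))} (ℕ.≰⇒> τ≰ρ)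
            | ℕ.m≤n⇒m∸n≡0 {suc (length ρ)} (ℕ.<⇒≤ (ℕ.≰⇒> τ≰ρ)) = refl

  -- Exhibits the aligned pair behind a prefix; `overrun-mismatch`, `plateau-mismatch` and
  -- `descent-mismatch` each refute its comparison with the first pair.
  zip-at : ∀ {s e} (σ τ v w : Word) → length σ ≡ length v →
    (s , e) ∈ zip (σ ++ s ∷ τ) (take (length (σ ++ s ∷ τ)) (v ++ e ∷ w))
  zip-at []      τ []      w _  = here refl
  zip-at (_ ∷ σ) τ (_ ∷ v) w eq = there (zip-at σ τ v w (ℕ.suc-injective eq))

  replicate-split : ∀ {A : Set} {x : A} {j b} → j < b →
    ∃ λ r → replicate b x ≡ replicate j x ++ x ∷ replicate r x
  replicate-split {j = zero}  {suc b} _         = b , refl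
  replicate-split {j = suc j} {suc b} (s≤s j<b) =
    let r , eq = replicate-split j<b in r , cong (_ ∷_) eq

  length-runs : ∀ {A B : Set} j {x : A} {y : B} → length (replicate j x) ≡ length (replicate j y)
  length-runs j = trans (List.length-replicate j) (sym (List.length-replicate j))

  -- The pattern still demands a `1` where the word has already turned to `e`.
  overrun-mismatch : ∀ {c e j b} τ w → e ≢ c → suc j < b →
    ¬ StartsLike (ones b ++ τ) (replicate (suc j) c ++ e ∷ w)
  overrun-mismatch {c} {j = j} τ w e≢c (s≤s j<b) (_ , same) with replicate-split {x = 1} j<b
  ... | r , eq rewrite eq | List.++-assoc (ones j) (1 ∷ ones r) τ =
    e≢c (sym (Equivalence.to (proj₂ (All.lookup (All.lookup same (here refl))
      (there (zip-at (ones j) (ones r ++ τ) (replicate j c) w (length-runs j))))) refl))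

  -- The `2` of the pattern falls on a `c` inside the run, equal to the first letter.
  plateau-mismatch : ∀ {c j b} ρ → 1 ≤ b → b < suc j →
    ¬ StartsLike (ones-two b) (replicate (suc j) c ++ ρ)
  plateau-mismatch {c} {j} {suc b} ρ _ (s≤s b<j) (_ , same) with replicate-split {x = c} b<j
  ... | r , eq rewrite eq | List.++-assoc (replicate b c) (c ∷ replicate r c) ρ
    with () ← Equivalence.from (proj₂ (All.lookup (All.lookup same (here refl))
      (there (zip-at (ones b) [] (replicate b c) (replicate r c ++ ρ) (length-runs b))))) refl

  descent-mismatch : ∀ {c e b} w → 1 ≤ b → ¬ c < e →
    ¬ StartsLike (ones-two b) (replicate b c ++ e ∷ w)
  descent-mismatch {c} {e} {suc b} w _ c≮e (_ , same) =
    c≮e (Equivalence.to (proj₁ (All.lookup (All.lookup same (here refl))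
      (there (zip-at (ones b) [] (replicate b c) w (length-runs b))))) ℕ.≤-refl)

  sameOrder-refl : ∀ {s} → SameOrder s s
  sameOrder-refl =
    mk⇔ (λ u<u → contradiction u<u (ℕ.<-irrefl refl)) (λ v<v → contradiction v<v (ℕ.<-irrefl refl)) ,
    mk⇔ (λ _ → refl) (λ _ → refl)

  run-match : ∀ {c a j} ρ → a ≤ j → StartsLike (ones a) (replicate j c ++ ρ)
  run-match {c} ρ a≤j = lengths a≤j , all-zip a≤j (all-zip a≤j sameOrder-refl)
    where
    lengths : ∀ {a j} → a ≤ j → length (ones a) ≡ length (take (length (ones a)) (replicate j c ++ ρ))
    lengths z≤n       = refl
    lengths (s≤s a≤j) = cong suc (lengths a≤j)

    all-zip : ∀ {P : ℕ × ℕ → Set} {a j} → a ≤ j → P (1 , c) →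
      All P (zip (ones a) (take (length (ones a)) (replicate j c ++ ρ)))
    all-zip z≤n       p = []
    all-zip (s≤s a≤j) p = p ∷ all-zip a≤j p

  ascent-match : ∀ {c e} b w → c < e → StartsLike (ones-two b) (replicate b c ++ e ∷ w)
  ascent-match {c} {e} b w c<e =
    lengths b , all-zip b (all-zip b sameOrder-refl up) (all-zip b down sameOrder-refl)
    where
    up : SameOrder (1 , c) (2 , e)
    up = mk⇔ (λ _ → c<e) (λ _ → ℕ.≤-refl) , mk⇔ (λ ()) (λ c≡e → contradiction c≡e (ℕ.<⇒≢ c<e))

    down : SameOrder (2 , e) (1 , c)
    down = mk⇔ (λ { (s≤s ()) }) (λ e<c → contradiction e<c (ℕ.<-asym c<e)) ,
           mk⇔ (λ ()) (λ e≡c → contradiction e≡c (ℕ.>⇒≢ c<e))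

    lengths : ∀ b → length (ones-two b) ≡ length (take (length (ones-two b)) (replicate b c ++ e ∷ w))
    lengths zero    = refl
    lengths (suc b) = cong suc (lengths b)

    all-zip : ∀ {P : ℕ × ℕ → Set} b → P (1 , c) → P (2 , e) →
      All P (zip (ones-two b) (take (length (ones-two b)) (replicate b c ++ e ∷ w)))
    all-zip zero    p p′ = p′ ∷ []
    all-zip (suc b) p p′ = p ∷ all-zip b p p′

  data RunEnds (c : ℕ) : Word → Set where
    end  : RunEnds c []
    turn : ∀ {e w} → e ≢ c → RunEnds c (e ∷ w)

  run-short : ∀ {c j b : ℕ} (τ : Word) → suc j < b ℕ.+ length τ →
    length (replicate (suc j) c ++ []) < length (ones b ++ τ)
  run-short {c} {j} {b} τ j<b = subst₂ _<_
    (sym (trans (cong length (List.++-identityʳ (replicate (suc j) c))) (List.length-replicate (suc j))))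
    (sym (trans (List.length-++ (ones b)) (cong (ℕ._+ length τ) (List.length-replicate b))))
    j<b

  long-mismatch : ∀ {c j b ρ} τ → RunEnds c ρ → suc j < b →
    ¬ StartsLike (ones b ++ τ) (replicate (suc j) c ++ ρ)
  long-mismatch {c} {j} {b} τ end j<b =
    short-mismatch {ones b ++ τ} (replicate (suc j) c ++ [])
      (run-short {c} {j} {b} τ (ℕ.≤-trans j<b (ℕ.m≤m+n b (length τ))))
  long-mismatch τ (turn {w = w} e≢c) j<b = overrun-mismatch τ w e≢c j<b

  -- Every suffix of the run of length at least `a` starts one occurrence and a shorter one starts
  -- none; truncated subtraction covers runs shorter than `a`.
  μ-ones-run : ∀ {a c ρ} → 1 ≤ a → RunEnds c ρ → ∀ j →
    μ (ones a) (replicate j c ++ ρ) ≡ suc j ∸ a ℕ.+ μ (ones a) ρ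
  μ-ones-run {a} {c} {ρ} 1≤a ends zero    = cong (ℕ._+ μ (ones a) ρ) (sym (ℕ.m≤n⇒m∸n≡0 1≤a))
  μ-ones-run {a} {c} {ρ} 1≤a ends (suc j) with a ℕ.≤? suc j
  ... | yes a≤j = begin
    μ (ones a) (c ∷ replicate j c ++ ρ)    ≡⟨ μ-match (ones a) c (replicate j c ++ ρ) (run-match ρ a≤j) ⟩
    suc (μ (ones a) (replicate j c ++ ρ))  ≡⟨ cong suc (μ-ones-run 1≤a ends j) ⟩
    suc (suc j ∸ a) ℕ.+ μ (ones a) ρ       ≡⟨ cong (ℕ._+ μ (ones a) ρ) (ℕ.+-∸-assoc 1 a≤j) ⟨
    suc (suc j) ∸ a ℕ.+ μ (ones a) ρ       ∎
    where open ≡-Reasoning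
  ... | no a≰j = begin
    μ (ones a) (c ∷ replicate j c ++ ρ)    ≡⟨ μ-mismatch (ones a) c (replicate j c ++ ρ) mismatch ⟩
    μ (ones a) (replicate j c ++ ρ)        ≡⟨ μ-ones-run 1≤a ends j ⟩
    suc j ∸ a ℕ.+ μ (ones a) ρ             ≡⟨ cong (ℕ._+ μ (ones a) ρ) both-0 ⟩
    suc (suc j) ∸ a ℕ.+ μ (ones a) ρ       ∎
    where
    open ≡-Reasoning
    j<a = ℕ.≰⇒> a≰j

    both-0 : suc j ∸ a ≡ suc (suc j) ∸ a
    both-0 = trans (ℕ.m≤n⇒m∸n≡0 (ℕ.<⇒≤ j<a)) (sym (ℕ.m≤n⇒m∸n≡0 j<a))

    mismatch : ¬ StartsLike (ones a) (replicate (suc j) c ++ ρ)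
    mismatch = subst (λ τ → ¬ StartsLike τ (replicate (suc j) c ++ ρ))
      (List.++-identityʳ (ones a)) (long-mismatch [] ends j<a)

  -- Only the suffix of length exactly `b` starts an occurrence: a longer one meets `c` in place of
  -- the `2`, a shorter one meets `e` too early.
  μ-ones-two-ascent : ∀ {b c e} w → 1 ≤ b → c < e → ∀ j →
    μ (ones-two b) (replicate j c ++ e ∷ w) ≡ reached b j ℕ.+ μ (ones-two b) (e ∷ w)
  μ-ones-two-ascent {b} {c} {e} w 1≤b c<e = go
    where
    open ≡-Reasoning
    rest = μ (ones-two b) (e ∷ w)

    go : ∀ j → μ (ones-two b) (replicate j c ++ e ∷ w) ≡ reached b j ℕ.+ rest
    go zero = cong (ℕ._+ rest) (sym (reached-> 1≤b))
    go (suc j) with ℕ.<-cmp b (suc j)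
    ... | tri< b<j _ _ = begin
      μ (ones-two b) (c ∷ replicate j c ++ e ∷ w)    ≡⟨ μ-mismatch (ones-two b) c _ (plateau-mismatch (e ∷ w) 1≤b b<j) ⟩
      μ (ones-two b) (replicate j c ++ e ∷ w)        ≡⟨ go j ⟩
      reached b j ℕ.+ rest                           ≡⟨ cong (ℕ._+ rest) (reached-≤ (ℕ.≤-pred b<j)) ⟩
      1 ℕ.+ rest                                     ≡⟨ cong (ℕ._+ rest) (reached-≤ (ℕ.<⇒≤ b<j)) ⟨
      reached b (suc j) ℕ.+ rest                     ∎
    ... | tri≈ _ ≡.refl _ = begin
      μ (ones-two b) (c ∷ replicate j c ++ e ∷ w)    ≡⟨ μ-match (ones-two b) c _ (ascent-match b w c<e) ⟩
      suc (μ (ones-two b) (replicate j c ++ e ∷ w))  ≡⟨ cong suc (go j) ⟩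
      suc (reached b j ℕ.+ rest)                     ≡⟨ cong (λ r → suc (r ℕ.+ rest)) (reached-> (ℕ.≤-refl {b})) ⟩
      1 ℕ.+ rest                                     ≡⟨ cong (ℕ._+ rest) (reached-≤ (ℕ.≤-refl {b})) ⟨
      reached b b ℕ.+ rest                           ∎
    ... | tri> _ _ j<b = begin
      μ (ones-two b) (c ∷ replicate j c ++ e ∷ w)    ≡⟨ μ-mismatch (ones-two b) c _ (long-mismatch [ 2 ] (turn (ℕ.>⇒≢ c<e)) j<b) ⟩
      μ (ones-two b) (replicate j c ++ e ∷ w)        ≡⟨ go j ⟩
      reached b j ℕ.+ rest                           ≡⟨ cong (ℕ._+ rest) (reached-> (ℕ.<⇒≤ j<b)) ⟩
      rest                                           ≡⟨ cong (ℕ._+ rest) (reached-> j<b) ⟨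
      reached b (suc j) ℕ.+ rest                     ∎

  data RunFalls (c : ℕ) : Word → Set where
    end  : RunFalls c []
    fall : ∀ {e w} → e < c → RunFalls c (e ∷ w)

  falls⇒ends : ∀ {c ρ} → RunFalls c ρ → RunEnds c ρ
  falls⇒ends end        = end
  falls⇒ends (fall e<c) = turn (ℕ.<⇒≢ e<c)

  μ-ones-two-fall : ∀ {b c ρ} → 1 ≤ b → RunFalls c ρ → ∀ j →
    μ (ones-two b) (replicate j c ++ ρ) ≡ μ (ones-two b) ρ
  μ-ones-two-fall 1≤b falls zero = refl
  μ-ones-two-fall {b} {c} {ρ} 1≤b falls (suc j) =
    trans (μ-mismatch (ones-two b) c (replicate j c ++ ρ) mismatch) (μ-ones-two-fall 1≤b falls j)
    where
    exact : ∀ {ρ} → RunFalls c ρ → b ≡ suc j → ¬ StartsLike (ones-two b) (replicate (suc j) c ++ ρ)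
    exact (fall {w = w} e<c) refl = descent-mismatch w 1≤b (ℕ.<-asym e<c)
    exact end refl = short-mismatch {ones-two b} (replicate (suc j) c ++ [])
      (run-short {c} {j} {b} [ 2 ] (ℕ.≤-reflexive (ℕ.+-comm 1 (suc j))))

    mismatch : ¬ StartsLike (ones-two b) (replicate (suc j) c ++ ρ)
    mismatch with ℕ.<-cmp b (suc j)
    ... | tri< b<j _ _ = plateau-mismatch ρ 1≤b b<j
    ... | tri≈ _ b≡j _ = exact falls b≡j
    ... | tri> _ _ j<b = long-mismatch [ 2 ] (falls⇒ends falls) j<b

-- Ring normalisation with integer coefficients.

module IntegerSolver {c ℓ} (R : CommutativeRing c ℓ) where

  open CommutativeRing R
  open import Algebra.Properties.Ring ring
  open import Algebra.Properties.CommutativeSemigroup +-commutativeSemigroup using (interchange)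
  open import Algebra.Properties.Semiring.Mult.TCOptimised semiring renaming (_×_ to infixl 8 _·_)
  open import Algebra.Solver.Ring.AlmostCommutativeRing
  open import Relation.Binary.Reasoning.Setoid setoid

  -- The canonical homomorphism from the integers. Their decidable equality serves the solver in
  -- rings whose own equality need not be decidable.
  ⟦_⟧ℤ : ℤ → Carrier
  ⟦ + n ⟧ℤ      = n · 1#
  ⟦ -[1+ n ] ⟧ℤ = - (suc n · 1#)

  ⟦⟧-neg : ∀ i → ⟦ ℤ.- i ⟧ℤ ≈ - ⟦ i ⟧ℤ
  ⟦⟧-neg (+ zero)  = sym -0#≈0#
  ⟦⟧-neg (+ suc n) = refl
  ⟦⟧-neg -[1+ n ]  = sym (-‿involutive _)

  ⟦⟧-⊖ : ∀ m n → ⟦ m ℤ.⊖ n ⟧ℤ ≈ m · 1# - n · 1#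
  ⟦⟧-⊖ m       zero    = sym (trans (+-congˡ -0#≈0#) (+-identityʳ _))
  ⟦⟧-⊖ zero    (suc n) = sym (+-identityˡ _)
  ⟦⟧-⊖ (suc m) (suc n) = begin
    ⟦ suc m ℤ.⊖ suc n ⟧ℤ                 ≡⟨ ≡.cong ⟦_⟧ℤ (ℤ.[1+m]⊖[1+n]≡m⊖n m n) ⟩
    ⟦ m ℤ.⊖ n ⟧ℤ                         ≈⟨ ⟦⟧-⊖ m n ⟩
    m · 1# - n · 1#                      ≈⟨ +-identityˡ _ ⟨
    0# + (m · 1# - n · 1#)               ≈⟨ +-congʳ (-‿inverseʳ 1#) ⟨
    (1# - 1#) + (m · 1# - n · 1#)        ≈⟨ interchange _ _ _ _ ⟩
    (1# + m · 1#) + (- 1# - n · 1#)      ≈⟨ +-cong (sym (1+× m 1#)) (-‿+-comm 1# (n · 1#)) ⟩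
    suc m · 1# - (1# + n · 1#)           ≈⟨ +-congˡ (-‿cong (1+× n 1#)) ⟨
    suc m · 1# - suc n · 1#              ∎

  ⟦⟧-+ : ∀ i j → ⟦ i ℤ.+ j ⟧ℤ ≈ ⟦ i ⟧ℤ + ⟦ j ⟧ℤ
  ⟦⟧-+ (+ m)    (+ n)    = ×-homo-+ 1# m n
  ⟦⟧-+ (+ m)    -[1+ n ] = ⟦⟧-⊖ m (suc n)
  ⟦⟧-+ -[1+ m ] (+ n)    = trans (⟦⟧-⊖ n (suc m)) (+-comm _ _)
  ⟦⟧-+ -[1+ m ] -[1+ n ] = begin
    - (suc (suc (m ℕ.+ n)) · 1#)       ≡⟨ ≡.cong (λ k → - (suc k · 1#)) (ℕ.+-suc m n) ⟨
    - ((suc m ℕ.+ suc n) · 1#)         ≈⟨ -‿cong (×-homo-+ 1# (suc m) (suc n)) ⟩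
    - (suc m · 1# + suc n · 1#)        ≈⟨ -‿+-comm _ _ ⟨
    - (suc m · 1#) - suc n · 1#        ∎

  ⟦⟧-pos-* : ∀ m n → ⟦ + m ℤ.* + n ⟧ℤ ≈ m · 1# * n · 1#
  ⟦⟧-pos-* m n = begin
    ⟦ + m ℤ.* + n ⟧ℤ   ≡⟨ ≡.cong ⟦_⟧ℤ (ℤ.pos-* m n) ⟨
    (m ℕ.* n) · 1#     ≈⟨ ×1-homo-* m n ⟩
    m · 1# * n · 1#    ∎

  ⟦⟧-pos*- : ∀ m j → ⟦ + m ℤ.* j ⟧ℤ ≈ m · 1# * ⟦ j ⟧ℤ
  ⟦⟧-pos*- m (+ n)    = ⟦⟧-pos-* m n
  ⟦⟧-pos*- m -[1+ n ] = begin
    ⟦ + m ℤ.* (ℤ.- + suc n) ⟧ℤ   ≡⟨ ≡.cong ⟦_⟧ℤ (ℤ.neg-distribʳ-* (+ m) (+ suc n)) ⟨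
    ⟦ ℤ.- (+ m ℤ.* + suc n) ⟧ℤ   ≈⟨ ⟦⟧-neg (+ m ℤ.* + suc n) ⟩
    - ⟦ + m ℤ.* + suc n ⟧ℤ       ≈⟨ -‿cong (⟦⟧-pos-* m (suc n)) ⟩
    - (m · 1# * suc n · 1#)      ≈⟨ -‿distribʳ-* _ _ ⟩
    m · 1# * - (suc n · 1#)      ∎

  ⟦⟧-* : ∀ i j → ⟦ i ℤ.* j ⟧ℤ ≈ ⟦ i ⟧ℤ * ⟦ j ⟧ℤ
  ⟦⟧-* (+ m)    j = ⟦⟧-pos*- m j
  ⟦⟧-* -[1+ m ] j = begin
    ⟦ (ℤ.- + suc m) ℤ.* j ⟧ℤ     ≡⟨ ≡.cong ⟦_⟧ℤ (ℤ.neg-distribˡ-* (+ suc m) j) ⟨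
    ⟦ ℤ.- (+ suc m ℤ.* j) ⟧ℤ     ≈⟨ ⟦⟧-neg (+ suc m ℤ.* j) ⟩
    - ⟦ + suc m ℤ.* j ⟧ℤ         ≈⟨ -‿cong (⟦⟧-pos*- (suc m) j) ⟩
    - (suc m · 1# * ⟦ j ⟧ℤ)      ≈⟨ -‿distribˡ-* _ _ ⟩
    - (suc m · 1#) * ⟦ j ⟧ℤ      ∎

  homomorphism : ℤ.+-*-rawRing -Raw-AlmostCommutative⟶ fromCommutativeRing R
  homomorphism = record
    { ⟦_⟧    = ⟦_⟧ℤ
    ; +-homo = ⟦⟧-+
    ; *-homo = ⟦⟧-*
    ; -‿homo = ⟦⟧-neg
    ; 0-homo = refl
    ; 1-homo = refl
    }

  ⟦⟧-≟ : ∀ i j → Maybe (⟦ i ⟧ℤ ≈ ⟦ j ⟧ℤ)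
  ⟦⟧-≟ i j = Maybe.map (λ i≡j → reflexive (≡.cong ⟦_⟧ℤ i≡j)) (dec⇒maybe (i ℤ.≟ j))

  open import Algebra.Solver.Ring ℤ.+-*-rawRing (fromCommutativeRing R) homomorphism ⟦⟧-≟ public
    using (solve; _:=_; _:+_; _:*_; _:-_; con)

-- Ring identities behind the functional equation.

module RunIdentities {c ℓ} (R : CommutativeRing c ℓ) where

  open CommutativeRing R
  open import Algebra.Properties.Semiring.Exp semiring using (_^_)
  open IntegerSolver R
  open import Relation.Binary.Reasoning.Setoid setoid

  -- In the application `f` is F, `x * g` collects its nonempty words, and `s`, `t` are the series E
  -- and B. Substituting `x * g = f - 1`, `x * u = s - 1` and `x * v = t - 1` gives
  -- `f = s + (t - 1) * (f - 1) * f`, which rearranges to the conclusion.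
  quadratic : ∀ {f g s t u v} x →
    f ≈ 1# + x * g → g ≈ u + x * (v * (g * f)) → s ≈ 1# + x * u → t ≈ 1# + x * v →
    (t - 1#) * f ^ 2 ≈ t * f - s
  quadratic {f} {g} {s} {t} {u} {v} x f≈ g≈ s≈ t≈ = begin
    (t - 1#) * f ^ 2
      ≈⟨ solve 2 (λ f t → (t :- con (+ 1)) :* (f :* (f :* con (+ 1)))
                   := t :* f :- (f :- (t :- con (+ 1)) :* ((f :- con (+ 1)) :* f))) refl f t ⟩
    t * f - (f - (t - 1#) * ((f - 1#) * f))
      ≈⟨ +-congˡ (-‿cong (+-cong f≈ (-‿cong (*-cong (+-congʳ t≈) (*-congʳ (+-congʳ f≈)))))) ⟩
    t * f - ((1# + x * g) - (1# + x * v - 1#) * ((1# + x * g - 1#) * f))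
      ≈⟨ +-congˡ (-‿cong (+-congʳ (+-congˡ (*-congˡ g≈)))) ⟩
    t * f - ((1# + x * (u + x * (v * (g * f)))) - (1# + x * v - 1#) * ((1# + x * g - 1#) * f))
      ≈⟨ solve 6 (λ t f g x u v →
           t :* f :- ((con (+ 1) :+ x :* (u :+ x :* (v :* (g :* f))))
                      :- (con (+ 1) :+ x :* v :- con (+ 1)) :* ((con (+ 1) :+ x :* g :- con (+ 1)) :* f))
           := t :* f :- (con (+ 1) :+ x :* u)) refl t f g x u v ⟩
    t * f - (1# + x * u)
      ≈⟨ +-congˡ (-‿cong s≈) ⟨
    t * f - s ∎

  module _ (x : Carrier) where

    split-zero : ∀ {s t} q → t ≈ q * s → t ≈ s + (q - 1#) * (x ^ 0 * s)
    split-zero {s} q t≈ = trans t≈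
      (solve 2 (λ q s → q :* s := s :+ (q :- con (+ 1)) :* (con (+ 1) :* s)) refl q s)

    -- Prepending a common coefficient `c` to both series moves the degree at which they begin to
    -- differ from `b` to `suc b`.
    split-suc : ∀ {c q s t s′ t′ r} b → s ≈ c + x * s′ → t ≈ c + x * t′ →
      t′ ≈ s′ + (q - 1#) * (x ^ b * r) → t ≈ s + (q - 1#) * (x ^ suc b * r)
    split-suc {c} {q} {s} {t} {s′} {t′} {r} b s≈ t≈ eq = begin
      t
        ≈⟨ t≈ ⟩
      c + x * t′
        ≈⟨ +-congˡ (*-congˡ eq) ⟩
      c + x * (s′ + (q - 1#) * (x ^ b * r))
        ≈⟨ solve 6 (λ c x s q y r → c :+ x :* (s :+ (q :- con (+ 1)) :* (y :* r))
             := c :+ x :* s :+ (q :- con (+ 1)) :* (x :* y :* r)) refl c x s′ q (x ^ b) r ⟩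
      c + x * s′ + (q - 1#) * (x ^ suc b * r)
        ≈⟨ +-congʳ s≈ ⟨
      s + (q - 1#) * (x ^ suc b * r) ∎

  module _ (p x : Carrier) where

    -- A common denominator of E and B as rational functions.
    D : Carrier
    D = (1# - x) * (1# - p * x)

    -- The coefficient of `f ^ 2` becomes `D * t - D`, and `1# - p * x - D` is `x - p * x ^ 2`.
    -- Keeping `S`, `T` and `U` abstract serves both cases of the theorem.
    clearDenominators : ∀ {f s t S T U} →
      D * s ≈ 1# - p * x + S → D * t ≈ 1# - p * x + T + U → (t - 1#) * f ^ 2 ≈ t * f - s →
      (x - p * x ^ 2 + T + U) * f ^ 2 ≈ (1# - p * x + T + U) * f - 1# + p * x - S
    clearDenominators {f} {s} {t} {S} {T} {U} s≈ t≈ eq = begin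
      (x - p * x ^ 2 + T + U) * f ^ 2
        ≈⟨ *-congʳ (solve 4 (λ p x T U → x :- p :* (x :* (x :* con (+ 1))) :+ T :+ U
             := con (+ 1) :- p :* x :+ T :+ U :- (con (+ 1) :- x) :* (con (+ 1) :- p :* x)) refl p x T U) ⟩
      (1# - p * x + T + U - D) * f ^ 2
        ≈⟨ *-congʳ (+-congʳ t≈) ⟨
      (D * t - D) * f ^ 2
        ≈⟨ solve 3 (λ d t g → (d :* t :- d) :* g := d :* ((t :- con (+ 1)) :* g)) refl D t (f ^ 2) ⟩
      D * ((t - 1#) * f ^ 2)
        ≈⟨ *-congˡ eq ⟩
      D * (t * f - s)
        ≈⟨ solve 4 (λ d t f s → d :* (t :* f :- s) := d :* t :* f :- d :* s) refl D t f s ⟩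
      D * t * f - D * s
        ≈⟨ +-cong (*-congʳ t≈) (-‿cong s≈) ⟩
      (1# - p * x + T + U) * f - (1# - p * x + S)
        ≈⟨ solve 3 (λ y z S → y :- (con (+ 1) :- z :+ S) := y :- con (+ 1) :+ z :- S)
             refl ((1# - p * x + T + U) * f) (p * x) S ⟩
      (1# - p * x + T + U) * f - 1# + p * x - S ∎

    run-base : ∀ {g} → g ≈ 1# + p * (x * g) → (1# - p * x) * g ≈ 1#
    run-base {g} g≈ = begin
      (1# - p * x) * g
        ≈⟨ solve 3 (λ p x g → (con (+ 1) :- p :* x) :* g := g :- p :* (x :* g)) refl p x g ⟩
      g - p * (x * g)
        ≈⟨ +-congʳ g≈ ⟩
      1# + p * (x * g) - p * (x * g)
        ≈⟨ solve 1 (λ y → con (+ 1) :+ y :- y := con (+ 1)) refl (p * (x * g)) ⟩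
      1# ∎

    run-zero : ∀ {g} → (1# - p * x) * g ≈ 1# → D * (p * g) ≈ 1# - p * x + (p - 1#) * x ^ 0
    run-zero {g} g≈ = begin
      D * (p * g)
        ≈⟨ solve 3 (λ p x g → (con (+ 1) :- x) :* (con (+ 1) :- p :* x) :* (p :* g)
             := (con (+ 1) :- x) :* p :* ((con (+ 1) :- p :* x) :* g)) refl p x g ⟩
      (1# - x) * p * ((1# - p * x) * g)
        ≈⟨ *-congˡ g≈ ⟩
      (1# - x) * p * 1#
        ≈⟨ solve 2 (λ p x → (con (+ 1) :- x) :* p :* con (+ 1)
             := con (+ 1) :- p :* x :+ (p :- con (+ 1)) :* con (+ 1)) refl p x ⟩
      1# - p * x + (p - 1#) * x ^ 0 ∎

    run-suc : ∀ {s s′} a → s ≈ 1# + x * s′ → D * s′ ≈ 1# - p * x + (p - 1#) * x ^ a →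
              D * s ≈ 1# - p * x + (p - 1#) * x ^ suc a
    run-suc {s} {s′} a s≈ eq = begin
      D * s
        ≈⟨ *-congˡ s≈ ⟩
      D * (1# + x * s′)
        ≈⟨ solve 3 (λ d x s → d :* (con (+ 1) :+ x :* s) := d :+ x :* (d :* s)) refl D x s′ ⟩
      D + x * (D * s′)
        ≈⟨ +-congˡ (*-congˡ eq) ⟩
      D + x * (1# - p * x + (p - 1#) * x ^ a)
        ≈⟨ solve 3 (λ p x y →
             (con (+ 1) :- x) :* (con (+ 1) :- p :* x) :+ x :* (con (+ 1) :- p :* x :+ (p :- con (+ 1)) :* y)
             := con (+ 1) :- p :* x :+ (p :- con (+ 1)) :* (x :* y)) refl p x (x ^ a) ⟩
      1# - p * x + (p - 1#) * x ^ suc a ∎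

    -- In the application `y`, `z`, `w` are `x ^ b`, `x ^ (a ∸ b)`, `x ^ a`, and `r` is E with
    -- `a ∸ b` for `a`. The powers enter the solver as atoms because their exponents are variables.
    joint-≥ : ∀ {q s t r y z w} → t ≈ s + (q - 1#) * (y * r) → w ≈ y * z →
      D * s ≈ 1# - p * x + (p - 1#) * w → D * r ≈ 1# - p * x + (p - 1#) * z →
      D * t ≈ 1# - p * x + q * (p - 1#) * w + (q - 1#) * (1# - p * x) * y
    joint-≥ {q} {s} {t} {r} {y} {z} {w} t≈ w≈ s≈ r≈ = begin
      D * t
        ≈⟨ *-congˡ t≈ ⟩
      D * (s + (q - 1#) * (y * r))
        ≈⟨ solve 5 (λ d s q y r → d :* (s :+ (q :- con (+ 1)) :* (y :* r))
             := d :* s :+ (q :- con (+ 1)) :* y :* (d :* r)) refl D s q y r ⟩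
      D * s + (q - 1#) * y * (D * r)
        ≈⟨ +-cong (trans s≈ (+-congˡ (*-congˡ w≈))) (*-congˡ r≈) ⟩
      1# - p * x + (p - 1#) * (y * z) + (q - 1#) * y * (1# - p * x + (p - 1#) * z)
        ≈⟨ solve 5 (λ p q x y z →
             con (+ 1) :- p :* x :+ (p :- con (+ 1)) :* (y :* z)
               :+ (q :- con (+ 1)) :* y :* (con (+ 1) :- p :* x :+ (p :- con (+ 1)) :* z)
             := con (+ 1) :- p :* x :+ q :* (p :- con (+ 1)) :* (y :* z)
               :+ (q :- con (+ 1)) :* (con (+ 1) :- p :* x) :* y) refl p q x y z ⟩
      1# - p * x + q * (p - 1#) * (y * z) + (q - 1#) * (1# - p * x) * y
        ≈⟨ +-congʳ (+-congˡ (*-congˡ w≈)) ⟨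
      1# - p * x + q * (p - 1#) * w + (q - 1#) * (1# - p * x) * y ∎

    -- From degree `b` on, E is purely geometric when `a < b`: there it equals `y * (m * g)` with
    -- `y = x ^ b`, `m = p ^ (b ∸ a + 1)` and `g` the inverse of `1# - p * x`.
    joint-< : ∀ {q s t g y m S} → t ≈ s + (q - 1#) * (y * (m * g)) →
      D * s ≈ 1# - p * x + S → (1# - p * x) * g ≈ 1# →
      D * t ≈ 1# - p * x + S + (q - 1#) * (1# - x) * m * y
    joint-< {q} {s} {t} {g} {y} {m} {S} t≈ s≈ g≈ = begin
      D * t
        ≈⟨ *-congˡ t≈ ⟩
      D * (s + (q - 1#) * (y * (m * g)))
        ≈⟨ solve 7 (λ p x s q y m g → let d = (con (+ 1) :- x) :* (con (+ 1) :- p :* x) in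
             d :* (s :+ (q :- con (+ 1)) :* (y :* (m :* g)))
             := d :* s :+ (q :- con (+ 1)) :* (con (+ 1) :- x) :* m :* y :* ((con (+ 1) :- p :* x) :* g))
             refl p x s q y m g ⟩
      D * s + (q - 1#) * (1# - x) * m * y * ((1# - p * x) * g)
        ≈⟨ +-cong s≈ (trans (*-congˡ g≈) (*-identityʳ _)) ⟩
      1# - p * x + S + (q - 1#) * (1# - x) * m * y ∎

-- The equations as a record parametrised by the ring operations: at ℤ[p,q]⟦x⟧,
-- Agda then compares operations one by one, whereas comparing the expressions
-- themselves unfolds them down to integer coefficients.
module _ {c ℓ} {A : Set c} (_≈_ : A → A → Set ℓ) (_+_ _*_ _-_ : A → A → A) (_^_ : A → ℕ → A)
         (1# p q x f : A) (a b : ℕ) where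

  record FunctionalEquation : Set ℓ where
    field
      case-≥ : b ≤ a →
        ((((x - (p * (x ^ 2))) + ((q * (p - 1#)) * (x ^ a)))
            + (((q - 1#) * (1# - (p * x))) * (x ^ b))) * (f ^ 2))
          ≈ (((((((1# - (p * x)) + ((q * (p - 1#)) * (x ^ a)))
              + (((q - 1#) * (1# - (p * x))) * (x ^ b))) * f)
              - 1#) + (p * x)) - ((p - 1#) * (x ^ a)))
      case-< : a < b →
        ((((x - (p * (x ^ 2))) + ((p - 1#) * (x ^ a)))
            + ((((q - 1#) * (1# - x)) * (p ^ (b ∸ a ℕ.+ 1))) * (x ^ b))) * (f ^ 2))
          ≈ (((((((1# - (p * x)) + ((p - 1#) * (x ^ a)))
              + ((((q - 1#) * (1# - x)) * (p ^ (b ∸ a ℕ.+ 1))) * (x ^ b))) * f)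
              - 1#) + (p * x)) - ((p - 1#) * (x ^ a)))

exponent-≥ : ∀ {a b} n → b ≤ a → suc (b ℕ.+ n) ∸ a ≡ suc n ∸ (a ∸ b)
exponent-≥ {a} {b} n b≤a = begin
  suc (b ℕ.+ n) ∸ a                ≡⟨ ≡.cong (_∸ a) (ℕ.+-suc b n) ⟨
  (b ℕ.+ suc n) ∸ a                ≡⟨ ≡.cong ((b ℕ.+ suc n) ∸_) (ℕ.m+[n∸m]≡n b≤a) ⟨
  (b ℕ.+ suc n) ∸ (b ℕ.+ (a ∸ b))  ≡⟨ ℕ.[m+n]∸[m+o]≡n∸o b (suc n) (a ∸ b) ⟩
  suc n ∸ (a ∸ b)                  ∎
  where open ≡.≡-Reasoning

-- For `a < b` the subtraction never truncates, so the exponent is linear in `n`.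
exponent-< : ∀ {a b} n → a < b → suc (b ℕ.+ n) ∸ a ≡ b ∸ a ℕ.+ 1 ℕ.+ n
exponent-< {a} {b} n a<b = begin
  suc (b ℕ.+ n) ∸ a      ≡⟨ ≡.cong (_∸ a) (ℕ.+-suc b n) ⟨
  (b ℕ.+ suc n) ∸ a      ≡⟨ ℕ.+-∸-comm (suc n) (ℕ.<⇒≤ a<b) ⟩
  b ∸ a ℕ.+ suc n        ≡⟨ ℕ.+-assoc (b ∸ a) 1 n ⟨
  b ∸ a ℕ.+ 1 ℕ.+ n      ∎
  where open ≡.≡-Reasoning

-- Generating series of the continuations, indexed by stack height and current run.

module RunSeries {c ℓ} (R : CommutativeRing c ℓ) (p q : CommutativeRing.Carrier R) where

  open CommutativeRing R
  open import Algebra.Properties.Semiring.Exp semiring using (_^_; ^-homo-*)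
  open import Relation.Binary.Reasoning.Setoid setoid
  open IntegerSolver R

  private
    module S where
      open PowerSeries R public
      open CommutativeRing commutativeRing public using
        (refl; sym; reflexive; trans; *-congˡ; _-_)
      open import Algebra.Properties.Semiring.Exp (CommutativeRing.semiring commutativeRing) public
        using (_^_; ^-homo-*)
    open S using (Series)
    module SS = IntegerSolver S.commutativeRing

    P Q : Series
    P = S.const p
    Q = S.const q

  -- For fixed `a` this is also, as a function of `j`, the series E.
  runWeight : ℕ → ℕ → Carrier
  runWeight a j = p ^ (suc j ∸ a)

  ascentWeight : ℕ → ℕ → Carrier
  ascentWeight b j = q ^ reached b j

  -- The largest index comes first, as when a stack is read from its top.
  below : (ℕ → Carrier) → ℕ → Carrier
  below f zero    = 0#
  below f (suc h) = f h + below f h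

  below-cong : ∀ {f g} → (∀ i → f i ≈ g i) → ∀ h → below f h ≈ below g h
  below-cong f≈g zero    = refl
  below-cong f≈g (suc h) = +-cong (f≈g h) (below-cong f≈g h)

  below-+ : ∀ f h m → below f (h ℕ.+ m) ≈ below f m + below (λ i → f (i ℕ.+ m)) h
  below-+ f zero    m = sym (+-identityʳ _)
  below-+ f (suc h) m = begin
    f (h ℕ.+ m) + below f (h ℕ.+ m)
      ≈⟨ +-congˡ (below-+ f h m) ⟩
    f (h ℕ.+ m) + (below f m + below (λ i → f (i ℕ.+ m)) h)
      ≈⟨ solve 3 (λ x y z → x :+ (y :+ z) := y :+ (x :+ z)) refl _ _ _ ⟩
    below f m + (f (h ℕ.+ m) + below (λ i → f (i ℕ.+ m)) h) ∎

  shift : Series → Series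
  shift f zero    = 0#
  shift f (suc n) = f n

  scale : Carrier → Series → Series
  scale r f n = r * f n

  const-* : ∀ r f → S.const r S.* f S.≈ scale r f
  const-* r f zero    = +-identityʳ _
  const-* r f (suc n) = trans (+-congˡ (S.*-zeroˡ f (λ _ → refl) n)) (+-identityʳ _)

  shift-X : ∀ f → S.X S.* f S.≈ shift f
  shift-X f zero    = trans (+-identityʳ _) (zeroˡ _)
  shift-X f (suc n) = begin
    0# * f (suc n) + (S.X ∘ suc S.* f) n  ≈⟨ +-congʳ (zeroˡ _) ⟩
    0# + (S.X ∘ suc S.* f) n              ≈⟨ +-identityˡ _ ⟩
    (S.X ∘ suc S.* f) n                   ≈⟨ S.*-cong {S.X ∘ suc} {S.1S} {f} tail-X S.refl n ⟩
    (S.1S S.* f) n                        ≈⟨ S.*-identityˡ f n ⟩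
    f n                                   ∎
    where
    tail-X : S.X ∘ suc S.≈ S.1S
    tail-X zero    = refl
    tail-X (suc _) = refl

  scale-* : ∀ r f g → scale r f S.* g S.≈ scale r (f S.* g)
  scale-* r f g n = begin
    (scale r f S.* g) n           ≈⟨ S.*-cong {g = g} (const-* r f) S.refl n ⟨
    ((S.const r S.* f) S.* g) n   ≈⟨ S.*-assoc (S.const r) f g n ⟩
    (S.const r S.* (f S.* g)) n   ≈⟨ const-* r (f S.* g) n ⟩
    scale r (f S.* g) n           ∎

  below-* : ∀ (f : ℕ → Series) g h n →
            ((λ k → below (λ i → f i k) h) S.* g) n ≈ below (λ i → (f i S.* g) n) h
  below-* f g zero    n = S.*-zeroˡ g (λ _ → refl) n
  below-* f g (suc h) n = trans
    (S.*-distribʳ g (f h) (λ k → below (λ i → f i k) h) n)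
    (+-congˡ (below-* f g h n))

  module _ (a b : ℕ) where

    -- The summands are the choices for the next letter: a new one, which ends the run with an
    -- ascent; the same one, which prolongs it; or one of the `h` letters underneath, which ends it
    -- with a descent.
    Φ : ℕ → ℕ → Series
    Φ h j zero    = runWeight a j
    Φ h j (suc n) =
      runWeight a j * ascentWeight b j * Φ (suc h) 1 n +
      (Φ h (suc j) n + runWeight a j * below (λ i → Φ i 1 n) h)

    grounded : ℕ → Series
    grounded m zero    = 1#
    grounded m (suc n) = below (λ i → Φ i 1 n) m

    -- Induction on the number of remaining letters. The word is cut where it first descends to one
    -- of the lowest `m` letters, and `grounded m` accounts for the rest, including the case where
    -- no such letter comes.
    Φ-shift : ∀ n m h j → Φ (h ℕ.+ m) j n ≈ (Φ h j S.* grounded m) n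
    Φ-shift zero    m h j = sym (trans (+-identityʳ _) (*-identityʳ _))
    Φ-shift (suc n) m h j = begin
      e * d * Φ (suc h ℕ.+ m) 1 n + (Φ (h ℕ.+ m) (suc j) n + e * below (λ i → Φ i 1 n) (h ℕ.+ m))
        ≈⟨ +-cong (*-congˡ (Φ-shift n m (suc h) 1)) (+-cong (Φ-shift n m h (suc j)) (*-congˡ lower)) ⟩
      e * d * (Φ (suc h) 1 S.* Sₘ) n +
        ((Φ h (suc j) S.* Sₘ) n + e * (Sₘ (suc n) + below (λ i → (Φ i 1 S.* Sₘ) n) h))
        -- Descending at once to the lowest `m` letters gives `e * Sₘ (suc n)`, the leading term of
        -- the Cauchy product, since `e` is the constant coefficient of `Φ h j`.
        ≈⟨ solve 6 (λ e d u v w z → e :* d :* u :+ (v :+ e :* (w :+ z))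
             := e :* w :+ (e :* d :* u :+ (v :+ e :* z))) refl e d _ _ _ _ ⟩
      e * Sₘ (suc n) + (e * d * (Φ (suc h) 1 S.* Sₘ) n +
        ((Φ h (suc j) S.* Sₘ) n + e * below (λ i → (Φ i 1 S.* Sₘ) n) h))
        ≈⟨ +-congˡ (+-cong (scale-* (e * d) (Φ (suc h) 1) Sₘ n) (+-congˡ (trans
             (scale-* e Low Sₘ n) (*-congˡ (below-* (λ i → Φ i 1) Sₘ h n))))) ⟨
      e * Sₘ (suc n) + ((scale (e * d) (Φ (suc h) 1) S.* Sₘ) n +
        ((Φ h (suc j) S.* Sₘ) n + (scale e Low S.* Sₘ) n))
        ≈⟨ +-congˡ (trans
             (S.*-distribʳ Sₘ (scale (e * d) (Φ (suc h) 1)) (Φ h (suc j) S.+ scale e Low) n)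
             (+-congˡ (S.*-distribʳ Sₘ (Φ h (suc j)) (scale e Low) n))) ⟨
      (Φ h j S.* Sₘ) (suc n) ∎
      where
      e   = runWeight a j
      d   = ascentWeight b j
      Sₘ  = grounded m
      Low : Series
      Low k = below (λ i → Φ i 1 k) h

      lower : below (λ i → Φ i 1 n) (h ℕ.+ m) ≈ Sₘ (suc n) + below (λ i → (Φ i 1 S.* Sₘ) n) h
      lower = trans (below-+ (λ i → Φ i 1 n) h m) (+-congˡ (below-cong (λ i → Φ-shift n m i 1) h))

    E B : ℕ → Series
    E j n = runWeight a (n ℕ.+ j)
    B j n = runWeight a (n ℕ.+ j) * ascentWeight b (n ℕ.+ j)

    -- With nothing underneath, the run can only grow until the word ends, which gives `E j`, or
    -- until a new letter is pushed, which gives `B j` times `Φ 1 1` shifted by that letter.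
    Φ-ground : ∀ n j → Φ 0 j n ≈ E j n + shift (B j S.* Φ 1 1) n
    Φ-ground zero    j = sym (+-identityʳ _)
    Φ-ground (suc n) j = begin
      e * d * Φ 1 1 n + (Φ 0 (suc j) n + e * 0#)
        ≈⟨ +-congˡ (+-congʳ (Φ-ground n (suc j))) ⟩
      e * d * Φ 1 1 n + (E (suc j) n + shift (B (suc j) S.* Φ 1 1) n + e * 0#)
        ≈⟨ solve 4 (λ u v w e → u :+ (v :+ w :+ e :* con (+ 0)) := v :+ (u :+ w)) refl _ _ _ e ⟩
      E (suc j) n + (e * d * Φ 1 1 n + shift (B (suc j) S.* Φ 1 1) n)
        ≈⟨ +-cong (reflexive (≡.cong (runWeight a) (ℕ.+-suc n j))) (tail n) ⟩
      E j (suc n) + (B j S.* Φ 1 1) n ∎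
      where
      e = runWeight a j
      d = ascentWeight b j
      tail : ∀ n → e * d * Φ 1 1 n + shift (B (suc j) S.* Φ 1 1) n ≈ (B j S.* Φ 1 1) n
      tail zero    = refl
      tail (suc n) = +-congˡ (S.*-cong {g = Φ 1 1}
        (λ k → reflexive (≡.cong (λ i → runWeight a i * ascentWeight b i) (ℕ.+-suc k j))) S.refl n)

  dropCoeffs : ℕ → Series → Series
  dropCoeffs b f n = f (b ℕ.+ n)

  -- Puts a factor `q` on the coefficients from degree `b` on; applied to `runWeight a` it gives the
  -- series B.
  jump : ℕ → Series → Series
  jump b f n = f n * ascentWeight b n

  powers : Series
  powers n = p ^ n

  private
    module RI = RunIdentities S.commutativeRing

  cons : ∀ f → f S.≈ S.const (f 0) S.+ S.X S.* (f ∘ suc)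
  cons f n = trans (go n) (+-congˡ (sym (shift-X (f ∘ suc) n)))
    where
    go : ∀ n → f n ≈ S.const (f 0) n + shift (f ∘ suc) n
    go zero    = sym (+-identityʳ _)
    go (suc n) = sym (+-identityˡ _)

  cons-1 : ∀ {f g} → f 0 ≈ 1# → (∀ n → f (suc n) ≈ g n) → f S.≈ S.1S S.+ S.X S.* g
  cons-1 {f} {g} f0 f+ n = trans (cons f n)
    (+-cong (const-cong n) (S.*-cong {S.X} {S.X} (λ _ → refl) f+ n))
    where
    const-cong : S.const (f 0) S.≈ S.1S
    const-cong zero    = f0
    const-cong (suc n) = refl

  powers-eq : (S.1S S.- P S.* S.X) S.* powers S.≈ S.1S
  powers-eq = RI.run-base P S.X λ n → trans
    (cons-1 {powers} {P S.* powers} refl (λ n → sym (const-* p powers n)) n)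
    (+-congˡ (x∙yz≈y∙xz n))
    where
    x∙yz≈y∙xz : S.X S.* (P S.* powers) S.≈ P S.* (S.X S.* powers)
    x∙yz≈y∙xz = SS.solve 3 (λ x y z → x SS.:* (y SS.:* z) SS.:= y SS.:* (x SS.:* z))
      S.refl S.X P powers

  P^ : ∀ k f → P S.^ k S.* f S.≈ scale (p ^ k) f
  P^ zero    f n = trans (S.*-identityˡ f n) (sym (*-identityˡ _))
  P^ (suc k) f n = begin
    ((P S.* P S.^ k) S.* f) n     ≈⟨ S.*-assoc P (P S.^ k) f n ⟩
    (P S.* (P S.^ k S.* f)) n     ≈⟨ const-* p (P S.^ k S.* f) n ⟩
    p * (P S.^ k S.* f) n         ≈⟨ *-congˡ (P^ k f n) ⟩
    p * (p ^ k * f n)             ≈⟨ *-assoc _ _ _ ⟨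
    p ^ suc k * f n               ∎

  -- Induction on `a`: at zero the series is `p` times the geometric one, and raising `a` by one
  -- prepends the coefficient 1.
  runWeight-eq : ∀ a → RI.D P S.X S.* runWeight a S.≈ (S.1S S.- P S.* S.X) S.+ (P S.- S.1S) S.* S.X S.^ a
  runWeight-eq zero    = S.trans
    (S.*-congˡ {RI.D P S.X} λ n → sym (const-* p powers n))
    (RI.run-zero P S.X powers-eq)
  runWeight-eq (suc a) = RI.run-suc P S.X a
    (cons-1 {runWeight (suc a)} {runWeight a} (reflexive (≡.cong (p ^_) (ℕ.0∸n≡0 a))) λ n → refl)
    (runWeight-eq a)

  jump-eq : ∀ b f → jump b f S.≈ f S.+ (Q S.- S.1S) S.* (S.X S.^ b S.* dropCoeffs b f)
  jump-eq zero    f = RI.split-zero S.X Q λ n →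
    trans (*-congˡ (*-identityʳ q)) (trans (*-comm _ _) (sym (const-* q f n)))
  jump-eq (suc b) f = RI.split-suc S.X {q = Q} b (cons f) jump-cons (jump-eq b (f ∘ suc))
    where
    jump-cons : jump (suc b) f S.≈ S.const (f 0) S.+ S.X S.* jump b (f ∘ suc)
    jump-cons n = trans (cons (jump (suc b) f) n) (+-congʳ (head n))
      where
      head : S.const (f 0 * 1#) S.≈ S.const (f 0)
      head zero    = *-identityʳ _
      head (suc n) = refl

  drop-≥ : ∀ {a b} → b ≤ a → dropCoeffs b (runWeight a) S.≈ runWeight (a ∸ b)
  drop-≥ b≤a n = reflexive (≡.cong (p ^_) (exponent-≥ n b≤a))

  drop-< : ∀ {a b} → a < b → dropCoeffs b (runWeight a) S.≈ P S.^ (b ∸ a ℕ.+ 1) S.* powers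
  drop-< {a} {b} a<b n = begin
    p ^ (suc (b ℕ.+ n) ∸ a)             ≡⟨ ≡.cong (p ^_) (exponent-< n a<b) ⟩
    p ^ (b ∸ a ℕ.+ 1 ℕ.+ n)             ≈⟨ ^-homo-* p (b ∸ a ℕ.+ 1) n ⟩
    p ^ (b ∸ a ℕ.+ 1) * p ^ n           ≈⟨ P^ (b ∸ a ℕ.+ 1) powers n ⟨
    (P S.^ (b ∸ a ℕ.+ 1) S.* powers) n  ∎

  X^-split : ∀ {a b} → b ≤ a → S.X S.^ a S.≈ S.X S.^ b S.* S.X S.^ (a ∸ b)
  X^-split {a} {b} b≤a = S.trans (S.reflexive (≡.cong (S.X S.^_) (≡.sym (ℕ.m+[n∸m]≡n b≤a))))
    (S.^-homo-* S.X b (a ∸ b))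

  quadratic-eq : ∀ {a b f} → 1 ≤ a → 1 ≤ b → f S.≈ grounded a b 1 →
    (jump b (runWeight a) S.- S.1S) S.* f S.^ 2 S.≈ jump b (runWeight a) S.* f S.- runWeight a
  quadratic-eq {a} {b} {f} 1≤a 1≤b f≈ =
    RI.quadratic {f} {Φ a b 0 1} {runWeight a} {jump b (runWeight a)} {E a b 1} {B a b 1} S.X
      (cons-1 {f} {Φ a b 0 1} (f≈ 0) λ n → trans (f≈ (suc n)) (+-identityʳ _))
      (λ n → trans (Φ-ground a b n 1) (+-congˡ (trans (sym (shift-X (B a b 1 S.* Φ a b 1 1) n))
        (S.*-congˡ {S.X} (S.*-congˡ {B a b 1} Φ₁) n))))
      (cons-1 {runWeight a} {E a b 1} (weight-0 1≤a) λ n → reflexive (≡.cong (runWeight a) (ℕ.+-comm 1 n)))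
      (cons-1 {jump b (runWeight a)} {B a b 1}
        (trans (*-cong (weight-0 1≤a) (reflexive (≡.cong (q ^_) (reached-> 1≤b)))) (*-identityʳ _))
        λ n → reflexive (≡.cong (jump b (runWeight a)) (ℕ.+-comm 1 n)))
    where
    weight-0 : ∀ {a} → 1 ≤ a → runWeight a 0 ≈ 1#
    weight-0 (s≤s {n = a} z≤n) = reflexive (≡.cong (p ^_) (ℕ.0∸n≡0 a))

    Φ₁ : Φ a b 1 1 S.≈ Φ a b 0 1 S.* f
    -- The word is cut where it returns to the single letter under the run: `h = 0` and `m = 1`.
    Φ₁ n = trans (Φ-shift a b n 1 0 1) (S.*-congˡ {Φ a b 0 1} (S.sym f≈) n)

-- The functional equation over an arbitrary coefficient ring.

module _ {c ℓ} (R : CommutativeRing c ℓ) (p₀ q₀ : CommutativeRing.Carrier R)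
         {a b : ℕ} (1≤a : 1 ≤ a) (1≤b : 1 ≤ b)
         {f : PowerSeries.Series R} (f≈ : PowerSeries._≈_ R f (RunSeries.grounded R p₀ q₀ a b 1)) where

  open CommutativeRing (PowerSeries.commutativeRing R)
  open import Algebra.Properties.Semiring.Exp semiring using (_^_)
  open RunSeries R p₀ q₀
  open RunIdentities (PowerSeries.commutativeRing R)

  private
    p q x : Carrier
    p = PowerSeries.const R p₀
    q = PowerSeries.const R q₀
    x = PowerSeries.X R

  functionalEquation : FunctionalEquation _≈_ _+_ _*_ _-_ _^_ 1# p q x f a b
  functionalEquation = record
    { case-≥ = λ b≤a → clearDenominators p x {f} {runWeight a} (runWeight-eq a)
        (joint-≥ p x {q} {runWeight a} {jump b (runWeight a)} {y = x ^ b} {x ^ (a ∸ b)}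
          (trans (jump-eq b (runWeight a))
            (+-congˡ {runWeight a} (*-congˡ {q - 1#} (*-congˡ {x ^ b} (drop-≥ b≤a)))))
          (X^-split b≤a) (runWeight-eq a) (runWeight-eq (a ∸ b)))
        (quadratic-eq 1≤a 1≤b f≈)
    ; case-< = λ a<b → clearDenominators p x {f} {runWeight a} (runWeight-eq a)
        (joint-< p x {q} {runWeight a} {jump b (runWeight a)} {powers} {x ^ b} {p ^ (b ∸ a ℕ.+ 1)}
          (trans (jump-eq b (runWeight a))
            (+-congˡ {runWeight a} (*-congˡ {q - 1#} (*-congˡ {x ^ b} (drop-< a<b)))))
          (runWeight-eq a) powers-eq)
        (quadratic-eq 1≤a 1≤b f≈)
    }

-- Total weights of non-crossing words.

module _ {c ℓ} (R : CommutativeRing c ℓ) where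
  open import Data.List using (map; foldr)
  open NonCrossingWords
  open Occurrences
  open CommutativeRing R
  open import Relation.Binary.Reasoning.Setoid setoid

  total : ∀ {A : Set} → (A → Carrier) → List A → Carrier
  total f xs = foldr _+_ 0# (map f xs)

  total-cong : ∀ {A : Set} {f g : A → Carrier} → (∀ x → f x ≈ g x) → ∀ xs → total f xs ≈ total g xs
  total-cong f≈g []       = refl
  total-cong f≈g (x ∷ xs) = +-cong (f≈g x) (total-cong f≈g xs)

  total-scale : ∀ {A : Set} r (f : A → Carrier) xs → total (λ x → r * f x) xs ≈ r * total f xs
  total-scale r f []       = sym (zeroʳ r)
  total-scale r f (x ∷ xs) = trans (+-congˡ (total-scale r f xs)) (sym (distribˡ r _ _))

  total-++ : ∀ {A : Set} (f : A → Carrier) xs ys → total f (xs ++ ys) ≈ total f xs + total f ys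
  total-++ f []       ys = sym (+-identityˡ _)
  total-++ f (x ∷ xs) ys = trans (+-congˡ (total-++ f xs ys)) (sym (+-assoc _ _ _))

  total-map : ∀ {A B : Set} (f : B → Carrier) (g : A → B) xs → total f (map g xs) ≈ total (f ∘ g) xs
  total-map f g xs = reflexive (≡.cong (foldr _+_ 0#) (≡.sym (List.map-∘ xs)))

  total-↭ : ∀ {A : Set} (f : A → Carrier) {xs ys} → xs ↭ ys → total f xs ≈ total f ys
  total-↭ f _↭_.refl = refl
  total-↭ f (_↭_.prep x xs↭ys) = +-congˡ (total-↭ f xs↭ys)
  total-↭ f (_↭_.swap {xs} {ys} x y xs↭ys) = begin
    f x + (f y + total f xs)  ≈⟨ +-assoc _ _ _ ⟨
    f x + f y + total f xs    ≈⟨ +-cong (+-comm _ _) (total-↭ f xs↭ys) ⟩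
    f y + f x + total f ys    ≈⟨ +-assoc _ _ _ ⟩
    f y + (f x + total f ys)  ∎
  total-↭ f (_↭_.trans xs↭ys ys↭zs) = trans (total-↭ f xs↭ys) (total-↭ f ys↭zs)

  module _ (p q : Carrier) {a b : ℕ} (1≤a : 1 ≤ a) (1≤b : 1 ≤ b) where
    open import Algebra.Properties.Semiring.Exp semiring using (_^_; ^-homo-*)
    open import Algebra.Properties.CommutativeSemigroup *-commutativeSemigroup using (interchange)
    open RunSeries R p q

    weight : Word → Carrier
    weight w = p ^ μ (ones a) w * q ^ μ (ones-two b) w

    weight-[] : weight [] ≈ 1#
    weight-[] = trans (*-cong (reflexive (≡.cong (p ^_) (μ-ones-[] 1≤a)))
                              (reflexive (≡.cong (q ^_) (μ-ones-two-[] 1≤b)))) (*-identityʳ 1#)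
      where
      μ-ones-[] : ∀ {a} → 1 ≤ a → μ (ones a) [] ≡ 0
      μ-ones-[] (s≤s {n = a} z≤n) rewrite ℕ.0∸n≡0 (length (ones a)) = ≡.refl

      μ-ones-two-[] : ∀ {b} → 1 ≤ b → μ (ones-two b) [] ≡ 0
      μ-ones-two-[] (s≤s {n = b} z≤n) rewrite ℕ.0∸n≡0 (length (ones-two b)) = ≡.refl

    weight-fall : ∀ {c ρ} → RunFalls c ρ → ∀ j → weight (replicate j c ++ ρ) ≈ runWeight a j * weight ρ
    weight-fall {c} {ρ} falls j = begin
      weight (replicate j c ++ ρ)
        ≡⟨ ≡.cong₂ (λ m n → p ^ m * q ^ n)
             (μ-ones-run 1≤a (falls⇒ends falls) j) (μ-ones-two-fall 1≤b falls j) ⟩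
      p ^ (suc j ∸ a ℕ.+ μ (ones a) ρ) * q ^ μ (ones-two b) ρ
        ≈⟨ *-congʳ (^-homo-* p (suc j ∸ a) (μ (ones a) ρ)) ⟩
      runWeight a j * p ^ μ (ones a) ρ * q ^ μ (ones-two b) ρ
        ≈⟨ *-assoc _ _ _ ⟩
      runWeight a j * weight ρ ∎

    weight-ascent : ∀ {c e} w → c < e → ∀ j →
      weight (replicate j c ++ e ∷ w) ≈ runWeight a j * ascentWeight b j * weight (e ∷ w)
    weight-ascent {c} {e} w c<e j = begin
      weight (replicate j c ++ e ∷ w)
        ≡⟨ ≡.cong₂ (λ m n → p ^ m * q ^ n)
             (μ-ones-run 1≤a (turn (ℕ.>⇒≢ c<e)) j) (μ-ones-two-ascent w 1≤b c<e j) ⟩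
      p ^ (suc j ∸ a ℕ.+ μ (ones a) (e ∷ w)) * q ^ (reached b j ℕ.+ μ (ones-two b) (e ∷ w))
        ≈⟨ *-cong (^-homo-* p (suc j ∸ a) _) (^-homo-* q (reached b j) _) ⟩
      (runWeight a j * p ^ μ (ones a) (e ∷ w)) * (ascentWeight b j * q ^ μ (ones-two b) (e ∷ w))
        ≈⟨ interchange _ _ _ _ ⟩
      runWeight a j * ascentWeight b j * weight (e ∷ w) ∎

    mutual
      -- The current run stays in front of the continuation, because its weight is settled only when
      -- it ends. The recursion of `continuations` then matches that of `Φ`.
      total-continuations : ∀ {c st m} n j → Stack (c ∷ st) m →
        total (λ w → weight (replicate j c ++ w)) (continuations (c ∷ st) m n) ≈ Φ a b (length st) j n
      total-continuations zero j sorted =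
        trans (+-identityʳ _) (trans (weight-fall end j) (trans (*-congˡ weight-[]) (*-identityʳ _)))
      total-continuations {c} {st} {m} (suc n) j sorted = begin
        total run (map (suc m ∷_) pushed ++ map (c ∷_) stayed ++ pops st m n)
          ≈⟨ total-++ run (map (suc m ∷_) pushed) _ ⟩
        total run (map (suc m ∷_) pushed) + total run (map (c ∷_) stayed ++ pops st m n)
          ≈⟨ +-congˡ (total-++ run (map (c ∷_) stayed) (pops st m n)) ⟩
        total run (map (suc m ∷_) pushed) + (total run (map (c ∷_) stayed) + total run (pops st m n))
          ≈⟨ +-cong
               (trans (total-map run (suc m ∷_) pushed)
                 (trans (total-cong (λ w → weight-ascent w c<m j) pushed)
                   (trans (total-scale _ (λ w → weight (suc m ∷ w)) pushed)
                     (*-congˡ (total-continuations n 1 (push sorted))))))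
               (+-cong
                 (trans (total-map run (c ∷_) stayed)
                   (trans (total-cong (λ w → reflexive (≡.cong weight (shift-run j w))) stayed)
                     (total-continuations n (suc j) sorted)))
                 (total-pops n j (pop sorted) c>st)) ⟩
        Φ a b (length st) j (suc n) ∎
        where
        run    = λ w → weight (replicate j c ++ w)
        pushed = continuations (suc m ∷ c ∷ st) (suc m) n
        stayed = continuations (c ∷ st) m n
        c<m : c < suc m
        c<m = s≤s (in-range sorted (here ≡.refl))
        c>st : All (_< c) st
        c>st = All.tabulate (below-top sorted)
        shift-run : ∀ j w → replicate j c ++ c ∷ w ≡ c ∷ replicate j c ++ w
        shift-run zero    w = ≡.refl
        shift-run (suc j) w = ≡.cong (c ∷_) (shift-run j w)

      -- Every word here starts below `c`, so the run of `c` ends in a descent and its weight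
      -- factors out.
      total-pops : ∀ {c st m} n j → Stack st m → All (_< c) st →
        total (λ w → weight (replicate j c ++ w)) (pops st m n)
          ≈ runWeight a j * below (λ i → Φ a b i 1 n) (length st)
      total-pops {st = []} n j sorted c>st = sym (zeroʳ _)
      total-pops {c} {d ∷ st} {m} n j sorted (d<c ∷ c>st) = begin
        total run (map (d ∷_) (continuations (d ∷ st) m n) ++ pops st m n)
          ≈⟨ total-++ run (map (d ∷_) (continuations (d ∷ st) m n)) (pops st m n) ⟩
        total run (map (d ∷_) (continuations (d ∷ st) m n)) + total run (pops st m n)
          ≈⟨ +-cong
               (trans (total-map run (d ∷_) (continuations (d ∷ st) m n))
                 (trans (total-cong (λ w → weight-fall (fall d<c) j) (continuations (d ∷ st) m n))
                   (trans (total-scale _ (λ w → weight (d ∷ w)) (continuations (d ∷ st) m n))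
                     (*-congˡ (total-continuations n 1 sorted)))))
               (total-pops n j (pop sorted) c>st) ⟩
        runWeight a j * Φ a b (length st) 1 n + runWeight a j * below (λ i → Φ a b i 1 n) (length st)
          ≈⟨ distribˡ _ _ _ ⟨
        runWeight a j * below (λ i → Φ a b i 1 n) (length (d ∷ st)) ∎
        where run = λ w → weight (replicate j c ++ w)

    total-NC : ∀ n → total weight (NC n) ≈ grounded a b 1 n
    total-NC n = trans (total-↭ weight (NC↭continuations n)) (from-empty n)
      where
      from-empty : ∀ n → total weight (continuations [] 0 n) ≈ grounded a b 1 n
      from-empty zero    = trans (+-identityʳ _) weight-[]
      -- On the empty stack the first letter must be 1, which starts a run of length one with
      -- nothing underneath.
      from-empty (suc n) = trans (total-++ weight (map (1 ∷_) (continuations (1 ∷ []) 1 n)) [])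
        (+-congʳ (trans (total-map weight (1 ∷_) (continuations (1 ∷ []) 1 n))
          (total-continuations n 1 (push ([] ∷ [])))))

theorem1 : (a b : ℕ) → 1 ≤ a → 1 ≤ b →
  let open GeneratingFunction
      f = F a b
  in
  (b ≤ a →
    (x - p * x ^ 2 + q * (p - 1#) * x ^ a + (q - 1#) * (1# - p * x) * x ^ b) * f ^ 2
      ≈ (1# - p * x + q * (p - 1#) * x ^ a + (q - 1#) * (1# - p * x) * x ^ b) * f
        - 1# + p * x - (p - 1#) * x ^ a)
  ×
  (a < b →
    (x - p * x ^ 2 + (p - 1#) * x ^ a + (q - 1#) * (1# - x) * p ^ (b ∸ a ℕ.+ 1) * x ^ b) * f ^ 2
      ≈ (1# - p * x + (p - 1#) * x ^ a + (q - 1#) * (1# - x) * p ^ (b ∸ a ℕ.+ 1) * x ^ b) * f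
        - 1# + p * x - (p - 1#) * x ^ a)
theorem1 a b 1≤a 1≤b = FunctionalEquation.case-≥ equation , FunctionalEquation.case-< equation
  where
  open GeneratingFunction
  module C = Coefficients
  equation : FunctionalEquation _≈_ _+_ _*_ _-_ _^_ 1# p q x (F a b) a b
  -- `F a b n` unfolds to the total of `weight` over `NC n`, so `total-NC` identifies F with
  -- `grounded a b 1`.
  equation = functionalEquation ℤ[p,q] C.p C.q 1≤a 1≤b (total-NC ℤ[p,q] C.p C.q 1≤a 1≤b)
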